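{- Let \(\mathcal L\subset \mathbb R^n\) be a full-rank integral lattice, \(n\ge 1\), and let \(k\ge 1\) be an integer. Then \[ N_{=k}(\mathcal L)= 2\binom{n+2k-2}{2k-1} \] holds if and only if one of the following mutually exclusive cases occurs: (i) \(n=1\), say \(\mathcal L=a\mathbb Z\) with \(a>0\) and \(a^2\in\mathbb Z\), and there exists \(m\in\mathbb Z\) with \(a^2m^2=k\) (equivalently, the one-dimensional lattice \(\mathcal L\) represents \(k\)); (ii) \(n\ge 2\), \(k=1\), and \(\mathcal L\) is isometric to \(\mathbb Z^n\); (iii) \(n=8\), \(k=2\), and \(\mathcal L\) is isometric to the \(E_8\) root lattice.
   Context: A lattice \(\mathcal L\subset\mathbb R^n\) is integral if \(\langle x,y\rangle\in\mathbb Z\) for all \(x,y\in\mathcal L\) (standard Euclidean inner product). For a positive integer \(k\), \(N_{=k}(\mathcal L)\) denotes the number of vectors \(y\in\mathcal L\) with \(\|y\|^2=k\). It is known (Regev–Stephens-Davidowitz) that always \(N_{=k}(\mathcal L)\le 2\binom{n+2k-2}{2k-1}\) for full-rank integral lattices. -}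

module Defs where

open import Data.Nat as ℕ using (ℕ; zero; suc)
open import Data.Integer as ℤ using (ℤ; +_; -[1+_]; _+_; _*_; _>_)
open import Data.Fin using (Fin; zero; suc)
open import Data.Vec using (Vec; lookup; []; _∷_)
open import Data.List using (List; length)
open import Data.List.Membership.Propositional using (_∈_)
open import Data.List.Relation.Unary.Unique.Propositional using (Unique)
open import Data.Product using (Σ; ∃; _×_)
open import Relation.Binary.PropositionalEquality using (_≡_; _≢_)
open import Relation.Nullary using (¬_)
open import Function.Bundles using (_⇔_)
open import Data.Bool using (if_then_else_)
open import Relation.Nullary.Decidable using (⌊_⌋)
open import Data.Fin using (_≟_)

Mat : ℕ → Set
Mat n = Fin n → Fin n → ℤ

sumFin : ∀ n → (Fin n → ℤ) → ℤ
sumFin zero    f = + 0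
sumFin (suc n) f = f zero + sumFin n (λ i → f (suc i))

_·_ : ∀ {n} → Mat n → Mat n → Mat n
_·_ {n} A B i j = sumFin n (λ l → A i l * B l j)

transpose : ∀ {n} → Mat n → Mat n
transpose A i j = A j i

idMat : ∀ {n} → Mat n
idMat i j = if ⌊ i ≟ j ⌋ then + 1 else + 0

Symmetric : ∀ {n} → Mat n → Set
Symmetric A = ∀ i j → A i j ≡ A j i

Q : ∀ {n} → Mat n → Vec ℤ n → ℤ
Q {n} G x = sumFin n (λ i → sumFin n (λ j → lookup x i * G i j * lookup x j))

zeroVec : ∀ n → Vec ℤ n
zeroVec zero    = []
zeroVec (suc n) = + 0 ∷ zeroVec n

PositiveDefinite : ∀ {n} → Mat n → Set
PositiveDefinite {n} G = ∀ (x : Vec ℤ n) → x ≢ zeroVec n → Q G x > + 0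

-- G is the Gram matrix of a full-rank integral lattice in ℝ^n
-- (w.r.t. some basis): symmetric, integer, positive definite.
IntegralGram : ∀ {n} → Mat n → Set
IntegralGram G = Symmetric G × PositiveDefinite G

-- Lattices with Gram matrices G and H are isometric iff
-- H = Uᵀ G U for some U ∈ GL_n(ℤ).
Isometric : ∀ {n} → Mat n → Mat n → Set
Isometric {n} G H =
  Σ (Mat n) λ U → Σ (Mat n) λ V →
    (∀ i j → (U · V) i j ≡ idMat i j) ×
    (∀ i j → ((transpose U · G) · U) i j ≡ H i j)

HasCount : {A : Set} → (A → Set) → ℕ → Set
HasCount {A} P c =
  Σ (List A) λ xs → (length xs ≡ c) × Unique xs × (∀ x → (x ∈ xs) ⇔ P x)

NumEq : ∀ {n} → Mat n → ℕ → ℕ → Set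
NumEq {n} G k c = HasCount (λ (x : Vec ℤ n) → Q G x ≡ + k) c

-- Gram matrix (Cartan matrix) of the E8 root lattice in a basis of
-- simple roots (Bourbaki labelling: chain 1-3-4-5-6-7-8, node 2 joined to 4).
private
  m1 : ℤ
  m1 = -[1+ 0 ]
  o : ℤ
  o = + 0
  t : ℤ
  t = + 2

E8rows : Vec (Vec ℤ 8) 8
E8rows =
  (t  ∷ o  ∷ m1 ∷ o  ∷ o  ∷ o  ∷ o  ∷ o  ∷ []) ∷
  (o  ∷ t  ∷ o  ∷ m1 ∷ o  ∷ o  ∷ o  ∷ o  ∷ []) ∷
  (m1 ∷ o  ∷ t  ∷ m1 ∷ o  ∷ o  ∷ o  ∷ o  ∷ []) ∷
  (o  ∷ m1 ∷ m1 ∷ t  ∷ m1 ∷ o  ∷ o  ∷ o  ∷ []) ∷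
  (o  ∷ o  ∷ o  ∷ m1 ∷ t  ∷ m1 ∷ o  ∷ o  ∷ []) ∷
  (o  ∷ o  ∷ o  ∷ o  ∷ m1 ∷ t  ∷ m1 ∷ o  ∷ []) ∷
  (o  ∷ o  ∷ o  ∷ o  ∷ o  ∷ m1 ∷ t  ∷ m1 ∷ []) ∷
  (o  ∷ o  ∷ o  ∷ o  ∷ o  ∷ o  ∷ m1 ∷ t  ∷ []) ∷ []

E8 : Mat 8
E8 i j = lookup (lookup E8rows i) j

{-# OPTIONS --safe #-}
module Submission where

-- Write ⟨x,y⟩ for the bilinear form and let d = 2k − 1. For x of norm k the form
--   f_x(y) = ⟨x,y⟩ ∏_{0<j<k} (k⟨x,y⟩² − j²⟨y,y⟩)
-- of degree d vanishes at every vector of norm k except ± x. So the f_x, one for each pair ± x, are independent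
-- in the space of forms of degree d, which has dimension C(n+d−1,d), and in the case of equality a form of
-- degree d that vanishes at all vectors of norm k is zero. Let n ≥ 2.
--   k ≥ 3: unless ⟨u,x⟩ = k − 1 for some u, x of norm k, a nonzero form vanishes at all vectors of norm k. Then
-- r = u − x has norm 2, |⟨r,x⟩| < k for all x of norm k, and f_r is a nonzero form vanishing at all of them.
--   k = 1: the vectors of norm 1 contain an orthonormal basis.
--   k = 2: no product of three nonzero linear forms vanishes at all roots. This yields two orthogonal roots
-- e₁ ± e₂, extends a root system D_m with coordinates e₁, …, e_m to D_{m+1} as long as m < n, and gives a root x
-- with x₁x₂x₃ ≠ 0 for the coordinates of D_n. All coordinates of x are then ± ½, so that 2 = n/4, and D₈ together
-- with x spans E8.
--   The independence of the f_x also shows that the explicit lists of vectors in the converse are complete.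

open import Defs

-- The factors of f_x account for every value that ⟨x,y⟩ can take: it is an integer, strictly
-- between -k and k when y ≠ ± x has norm k, and the quadratic form only makes j² homogeneous. A
-- form counts as nonzero once a lattice vector with nonzero value is at hand, so each use of
-- equality needs such a vector besides the form. A vector r of norm 2 satisfies |⟨r,x⟩| < (k + 2)/2
-- ≤ k unless x = ± r. For k ≥ 3 the exception cannot occur, as the norms differ; for k = 2 it does,
-- and roots need an argument of their own. When D_m is extended, two of the three linear forms are
-- the products with e₁ ± e₂, which leave for (x₁, x₂) only (± 1, 0) and (0, ± 1); the third
-- vanishes on D_m and so keeps x away from its roots. The eᵢ need not lie in the lattice and all
-- arithmetic is integral. Hence frames carry 2eᵢ and eᵢ + eⱼ, and identities with halves are
-- multiplied out and tested by inner products.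

module Extremal where

  open import Data.Nat as ℕ using (ℕ; zero; suc; s≤s; z≤n)
  import Data.Nat.Properties as ℕₚ
  open import Data.Nat.Combinatorics using (_C_; nCn≡1; nCk+nC[k+1]≡[n+1]C[k+1])
  open import Data.Integer as ℤ using (ℤ; -[1+_]; 0ℤ; 1ℤ; -1ℤ; _+_; _*_; -_; _-_)
  open import Data.Integer.Properties as ℤₚ hiding (_≟_)
  open import Data.Integer.Tactic.RingSolver using (solve-∀)
  open import Data.Fin as Fin using (Fin; zero; suc; punchIn; _↑ˡ_; _↑ʳ_; #_)
  open import Data.Fin.Properties as Finₚ using ()
  open import Data.Vec as Vec using (Vec; []; _∷_; lookup)
  open import Data.Vec.Functional as VF using (insertAt)
  open import Data.Vec.Functional.Properties using (insertAt-lookup; insertAt-punchIn; lookup-++ˡ; lookup-++ʳ)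
  open import Data.List as List using (List; []; _∷_; length)
  open import Data.List.Relation.Unary.All as All using (All; []; _∷_)
  open import Data.List.Relation.Unary.AllPairs as AllPairs using (AllPairs; []; _∷_)
  open import Data.Product using (Σ; ∃; _×_; _,_; proj₁; proj₂)
  open import Data.Sum using (_⊎_; inj₁; inj₂; [_,_]′)
  open import Data.Empty using (⊥)
  open import Function using (_∘_; id)
  open import Relation.Nullary using (¬_; Dec; yes; no; contradiction; ¬?)
  open import Relation.Nullary.Decidable using (decidable-stable; toWitness; _×-dec_)
  open import Relation.Binary.PropositionalEquality using (_≡_; _≢_; refl; sym; trans; cong; cong₂; subst; module ≡-Reasoning)
  open import Data.Nat.Divisibility as ℕᵈ using (divides)
  import Data.Vec.Properties as Vecₚ
  import Data.List.Properties as Listₚ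
  import Data.List.Relation.Unary.All.Properties as Allₚ
  import Data.List.Relation.Unary.AllPairs.Properties as AllPairsₚ
  import Data.List.Relation.Unary.Unique.Propositional.Properties as Uniqueₚ
  open import Data.List.Relation.Unary.Unique.Propositional using (Unique)
  open import Data.List.Relation.Unary.Any as Any using (here; there)
  open import Data.List.Membership.Propositional using (_∈_; find)
  open import Data.List.Membership.Propositional.Properties using (∈-lookup; ∈-map⁺; ∈-map⁻; ∈-++⁺ˡ; ∈-++⁺ʳ; ∈-++⁻)
  import Data.List.Membership.DecPropositional as DecMembership
  import Data.Nat.Tactic.RingSolver as ℕRing
  open import Function.Bundles using (mk⇔; module Equivalence)
  open import Data.Nat.DivMod using (_/_; _%_)

  open ≡-Reasoning

  -- Integer linear algebra

  sum-cong : ∀ n {f g : Fin n → ℤ} → (∀ i → f i ≡ g i) → sumFin n f ≡ sumFin n g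
  sum-cong zero    e = refl
  sum-cong (suc n) e = cong₂ _+_ (e zero) (sum-cong n (e ∘ suc))

  sum-0 : ∀ n {f : Fin n → ℤ} → (∀ i → f i ≡ 0ℤ) → sumFin n f ≡ 0ℤ
  sum-0 zero    e = refl
  sum-0 (suc n) e = cong₂ _+_ (e zero) (sum-0 n (e ∘ suc))

  sum-+ : ∀ n (f g : Fin n → ℤ) → sumFin n (λ i → f i + g i) ≡ sumFin n f + sumFin n g
  sum-+ zero    f g = refl
  sum-+ (suc n) f g = trans (cong (f zero + g zero +_) (sum-+ n (f ∘ suc) (g ∘ suc)))
      (interchange (f zero) (g zero) (sumFin n (f ∘ suc)) (sumFin n (g ∘ suc)))
    where
    interchange : ∀ a b c d → (a + b) + (c + d) ≡ (a + c) + (b + d)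
    interchange = solve-∀

  sum-*ˡ : ∀ n c (f : Fin n → ℤ) → sumFin n (λ i → c * f i) ≡ c * sumFin n f
  sum-*ˡ zero    c f = sym (*-zeroʳ c)
  sum-*ˡ (suc n) c f = trans (cong (c * f zero +_) (sum-*ˡ n c (f ∘ suc))) (sym (*-distribˡ-+ c (f zero) (sumFin n (f ∘ suc))))

  sum-*ʳ : ∀ n c (f : Fin n → ℤ) → sumFin n (λ i → f i * c) ≡ sumFin n f * c
  sum-*ʳ n c f = trans (sum-cong n (λ i → *-comm (f i) c)) (trans (sum-*ˡ n c f) (*-comm c _))

  sum-swap : ∀ m n (f : Fin m → Fin n → ℤ) →
    sumFin m (λ i → sumFin n (f i)) ≡ sumFin n (λ j → sumFin m (λ i → f i j))
  sum-swap zero    n f = sym (sum-0 n (λ _ → refl))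
  sum-swap (suc m) n f = trans (cong (sumFin n (f zero) +_) (sum-swap m n (f ∘ suc)))
      (sym (sum-+ n (f zero) (λ j → sumFin m (λ i → f (suc i) j))))

  sum-remove : ∀ n (f : Fin (suc n) → ℤ) i → sumFin (suc n) f ≡ f i + sumFin n (f ∘ punchIn i)
  sum-remove n       f zero    = refl
  sum-remove (suc n) f (suc i) =
    trans (cong (f zero +_) (sum-remove n (f ∘ suc) i)) (exchange (f zero) (f (suc i)) (sumFin n (f ∘ suc ∘ punchIn i)))
    where
    exchange : ∀ a b c → a + (b + c) ≡ b + (a + c)
    exchange = solve-∀

  sum-single : ∀ n (f : Fin n → ℤ) i → (∀ j → j ≢ i → f j ≡ 0ℤ) → sumFin n f ≡ f i
  sum-single (suc n) f i z =
    trans (sum-remove n f i)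
      (trans (cong (f i +_) (sum-0 n (λ j → z _ (Finₚ.punchInᵢ≢i i j)))) (+-identityʳ _))

  -- Fraction-free elimination of a pivot column.
  kernel : ∀ {m n} → m ℕ.< n → (A : Fin m → Fin n → ℤ) →
    Σ (Fin n → ℤ) λ c → (∃ λ j → c j ≢ 0ℤ) × (∀ i → sumFin n (λ j → A i j * c j) ≡ 0ℤ)
  kernel {zero}  {suc n} _ A = (λ _ → 1ℤ) , (zero , λ ()) , λ ()
  kernel {suc m} {suc n} (s≤s m<n) A with Finₚ.any? (λ j → ¬? (A zero j ℤ.≟ 0ℤ))
  ... | no all0 = c , nz , λ { zero → row₀ ; (suc i) → rows i }
    where
    rec = kernel (ℕₚ.m<n⇒m<1+n m<n) (A ∘ suc)
    c = proj₁ rec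
    nz = proj₁ (proj₂ rec)
    rows = proj₂ (proj₂ rec)
    row₀ : sumFin (suc n) (λ j → A zero j * c j) ≡ 0ℤ
    row₀ = sum-0 (suc n) λ j →
      cong (_* c j) (decidable-stable (A zero j ℤ.≟ 0ℤ) (λ ne → all0 (j , ne)))
  ... | yes (p , a≢0) = c , nz , λ { zero → row₀ ; (suc i) → rows i }
    where
    a = A zero p
    A′ : Fin m → Fin n → ℤ
    A′ i l = a * A (suc i) (punchIn p l) - A zero (punchIn p l) * A (suc i) p
    rec = kernel m<n A′
    c′ = proj₁ rec
    s = sumFin n (λ l → A zero (punchIn p l) * c′ l)
    -- Scaling the other unknowns by the pivot `a` makes -s an integral solution for the pivot
    -- unknown.
    c : Fin (suc n) → ℤ
    c = insertAt (λ l → a * c′ l) p (- s)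
    nz : ∃ λ j → c j ≢ 0ℤ
    nz = let (j , c′j≢0) = proj₁ (proj₂ rec) in
      punchIn p j , λ e → [ a≢0 , c′j≢0 ]′ (i*j≡0⇒i≡0∨j≡0 a
        (trans (sym (insertAt-punchIn (λ l → a * c′ l) p (- s) j)) e))
    row : ∀ i → sumFin (suc n) (λ j → A i j * c j)
              ≡ A i p * (- s) + a * sumFin n (λ l → A i (punchIn p l) * c′ l)
    row i = begin
      sumFin (suc n) (λ j → A i j * c j)
        ≡⟨ sum-remove n (λ j → A i j * c j) p ⟩
      A i p * c p + sumFin n (λ l → A i (punchIn p l) * c (punchIn p l))
        ≡⟨ cong₂ _+_ (cong (A i p *_) (insertAt-lookup _ p (- s)))
             (trans (sum-cong n λ l → trans (cong (A i (punchIn p l) *_) (insertAt-punchIn _ p (- s) l))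
                                            (move (A i (punchIn p l)) a (c′ l)))
                    (sum-*ˡ n a _)) ⟩
      A i p * (- s) + a * sumFin n (λ l → A i (punchIn p l) * c′ l) ∎
      where
      move : ∀ x y z → x * (y * z) ≡ y * (x * z)
      move = solve-∀
    row₀ : sumFin (suc n) (λ j → A zero j * c j) ≡ 0ℤ
    row₀ = trans (row zero) (cancel a s)
      where
      cancel : ∀ x y → x * (- y) + x * y ≡ 0ℤ
      cancel = solve-∀
    rows : ∀ i → sumFin (suc n) (λ j → A (suc i) j * c j) ≡ 0ℤ
    rows i = trans (row (suc i)) (trans (sym expand) (proj₂ (proj₂ rec) i))
      where
      b = A (suc i) p
      u v : Fin n → ℤ
      u l = A (suc i) (punchIn p l) * c′ l
      v l = A zero (punchIn p l) * c′ l
      dist : ∀ x y z w t → (x * y - z * w) * t ≡ x * (y * t) + (- w) * (z * t)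
      dist = solve-∀
      swap : ∀ x y z → x + (- y) * z ≡ y * (- z) + x
      swap = solve-∀
      expand : sumFin n (λ l → A′ i l * c′ l) ≡ b * (- s) + a * sumFin n u
      expand = begin
        sumFin n (λ l → A′ i l * c′ l)
          ≡⟨ sum-cong n (λ l → dist a (A (suc i) (punchIn p l)) (A zero (punchIn p l)) b (c′ l)) ⟩
        sumFin n (λ l → a * u l + (- b) * v l)
          ≡⟨ sum-+ n _ _ ⟩
        sumFin n (λ l → a * u l) + sumFin n (λ l → (- b) * v l)
          ≡⟨ cong₂ _+_ (sum-*ˡ n a u) (sum-*ˡ n (- b) v) ⟩
        a * sumFin n u + (- b) * s
          ≡⟨ swap (a * sumFin n u) b s ⟩
        b * (- s) + a * sumFin n u ∎

  -- Homogeneous forms with integer coefficients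

  -- Counts monomials of degree d in n variables by whether the first variable occurs, the same
  -- split that `eval` makes, so that coefficient vectors decompose definitionally.
  dim : ℕ → ℕ → ℕ
  dim zero    zero    = 1
  dim zero    (suc d) = 0
  dim (suc n) zero    = 1
  dim (suc n) (suc d) = dim (suc n) d ℕ.+ dim n (suc d)

  dim-C : ∀ n d → dim (suc n) d ≡ (n ℕ.+ d) C d
  dim-C n       zero    = refl
  dim-C zero    (suc d) = trans (ℕₚ.+-identityʳ _) (trans (dim-C zero d) (trans (nCn≡1 d) (sym (nCn≡1 (suc d)))))
  dim-C (suc n) (suc d) = begin
    dim (suc (suc n)) d ℕ.+ dim (suc n) (suc d)
      ≡⟨ cong₂ ℕ._+_ (dim-C (suc n) d) (dim-C n (suc d)) ⟩
    (suc n ℕ.+ d) C d ℕ.+ (n ℕ.+ suc d) C suc d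
      ≡⟨ cong (λ m → (suc n ℕ.+ d) C d ℕ.+ m C suc d) (ℕₚ.+-suc n d) ⟩
    (suc n ℕ.+ d) C d ℕ.+ (suc n ℕ.+ d) C suc d
      ≡⟨ nCk+nC[k+1]≡[n+1]C[k+1] (suc n ℕ.+ d) d ⟩
    suc (suc n ℕ.+ d) C suc d
      ≡⟨ cong (_C suc d) (sym (cong suc (ℕₚ.+-suc n d))) ⟩
    (suc n ℕ.+ suc d) C suc d ∎

  -- A form of degree d+1 in (x , y) is x · g(x , y) + h(y), with g of degree d and h of degree d+1.
  eval : ∀ n d → (Fin (dim n d) → ℤ) → Vec ℤ n → ℤ
  eval zero    zero    c []       = c zero
  eval zero    (suc d) c []       = 0ℤ
  eval (suc n) zero    c (x ∷ xs) = c zero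
  eval (suc n) (suc d) c (x ∷ xs) =
    x * eval (suc n) d (λ i → c (i ↑ˡ dim n (suc d))) (x ∷ xs) + eval n (suc d) (λ i → c (dim (suc n) d ↑ʳ i)) xs

  eval-cong : ∀ n d {c c′ : Fin (dim n d) → ℤ} → (∀ i → c i ≡ c′ i) → ∀ y → eval n d c y ≡ eval n d c′ y
  eval-cong zero    zero    e []       = e zero
  eval-cong zero    (suc d) e []       = refl
  eval-cong (suc n) zero    e (x ∷ xs) = e zero
  eval-cong (suc n) (suc d) e (x ∷ xs) =
    cong₂ (λ a b → x * a + b) (eval-cong (suc n) d (λ i → e _) (x ∷ xs)) (eval-cong n (suc d) (λ i → e _) xs)

  eval-+ : ∀ n d (c c′ : Fin (dim n d) → ℤ) y → eval n d (λ i → c i + c′ i) y ≡ eval n d c y + eval n d c′ y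
  eval-+ zero    zero    c c′ []       = refl
  eval-+ zero    (suc d) c c′ []       = refl
  eval-+ (suc n) zero    c c′ (x ∷ xs) = refl
  eval-+ (suc n) (suc d) c c′ (x ∷ xs) =
    trans (cong₂ (λ a b → x * a + b) (eval-+ (suc n) d _ _ (x ∷ xs)) (eval-+ n (suc d) _ _ xs)) (rearrange x _ _ _ _)
    where
    rearrange : ∀ x a b c d → x * (a + b) + (c + d) ≡ (x * a + c) + (x * b + d)
    rearrange = solve-∀

  eval-* : ∀ n d a (c : Fin (dim n d) → ℤ) y → eval n d (λ i → a * c i) y ≡ a * eval n d c y
  eval-* zero    zero    a c []       = refl
  eval-* zero    (suc d) a c []       = sym (*-zeroʳ a)
  eval-* (suc n) zero    a c (x ∷ xs) = refl
  eval-* (suc n) (suc d) a c (x ∷ xs) =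
    trans (cong₂ (λ u v → x * u + v) (eval-* (suc n) d a _ (x ∷ xs)) (eval-* n (suc d) a _ xs)) (rearrange x a _ _)
    where
    rearrange : ∀ x a u v → x * (a * u) + a * v ≡ a * (x * u + v)
    rearrange = solve-∀

  eval-0 : ∀ n d (c : Fin (dim n d) → ℤ) → (∀ i → c i ≡ 0ℤ) → ∀ y → eval n d c y ≡ 0ℤ
  eval-0 n d c z y = begin
    eval n d c y                 ≡⟨ eval-cong n d z y ⟩
    eval n d (λ i → 0ℤ * 0ℤ) y   ≡⟨ eval-* n d 0ℤ (λ _ → 0ℤ) y ⟩
    0ℤ                           ∎

  eval-sum : ∀ n d m (c : Fin m → Fin (dim n d) → ℤ) (b : Fin m → ℤ) y →
    eval n d (λ i → sumFin m (λ j → c j i * b j)) y ≡ sumFin m (λ j → eval n d (c j) y * b j)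
  eval-sum n d zero    c b y = eval-0 n d _ (λ _ → refl) y
  eval-sum n d (suc m) c b y =
    trans (eval-+ n d _ _ y) (cong₂ _+_
      (trans (eval-cong n d (λ i → *-comm (c zero i) (b zero)) y) (trans (eval-* n d (b zero) (c zero) y) (*-comm (b zero) _)))
      (eval-sum n d m (c ∘ suc) (b ∘ suc) y))

  -- Forms are handled as functions with some coefficient vector; uniqueness of the coefficients is
  -- never called upon.
  IsForm : ∀ n → ℕ → (Vec ℤ n → ℤ) → Set
  IsForm n d f = Σ (Fin (dim n d) → ℤ) λ c → ∀ y → eval n d c y ≡ f y

  form-ext : ∀ {n d f g} → (∀ y → f y ≡ g y) → IsForm n d f → IsForm n d g
  form-ext e (c , ev) = c , λ y → trans (ev y) (e y)

  form-+ : ∀ {n d f g} → IsForm n d f → IsForm n d g → IsForm n d (λ y → f y + g y)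
  form-+ {n} {d} (c , e) (c′ , e′) = (λ i → c i + c′ i) , λ y → trans (eval-+ n d c c′ y) (cong₂ _+_ (e y) (e′ y))

  form-* : ∀ {n d f} a → IsForm n d f → IsForm n d (λ y → a * f y)
  form-* {n} {d} a (c , e) = (λ i → a * c i) , λ y → trans (eval-* n d a c y) (cong (a *_) (e y))

  form-0 : ∀ {n d} → IsForm n d (λ _ → 0ℤ)
  form-0 {n} {d} = (λ _ → 0ℤ) , eval-0 n d _ (λ _ → refl)

  form-const : ∀ {n} a → IsForm n 0 (λ _ → a)
  form-const {zero}  a = (λ _ → a) , λ { [] → refl }
  form-const {suc n} a = (λ _ → a) , λ { (x ∷ xs) → refl }

  form-sum : ∀ {n d} m {f : Fin m → Vec ℤ n → ℤ} → (∀ i → IsForm n d (f i)) → IsForm n d (λ y → sumFin m (λ i → f i y))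
  form-sum zero    h = form-0
  form-sum (suc m) h = form-+ (h zero) (form-sum m (h ∘ suc))

  form-glue : ∀ {n d g h} → IsForm (suc n) d g → IsForm n (suc d) h →
    IsForm (suc n) (suc d) (λ y → Vec.head y * g y + h (Vec.tail y))
  form-glue {n} {d} (c , e) (c′ , e′) = c VF.++ c′ , λ { (x ∷ xs) → cong₂ (λ a b → x * a + b)
    (trans (eval-cong (suc n) d (lookup-++ˡ c c′) (x ∷ xs)) (e (x ∷ xs)))
    (trans (eval-cong n (suc d) (lookup-++ʳ c c′) xs) (e′ xs)) }

  -- The basic product: multiplication by inner products and by the quadratic form is assembled from
  -- this one and linear combinations.
  form-coord : ∀ {n d f} i → IsForm n d f → IsForm n (suc d) (λ y → lookup y i * f y)
  form-coord {suc n} {d} zero h =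
    form-ext (λ { (x ∷ xs) → +-identityʳ _ }) (form-glue h form-0)
  form-coord {suc n} {zero} {f} (suc i) (c , e) =
    form-ext {d = 1} (λ { y@(x ∷ xs) → trans (+-identityˡ′ x _) (cong (lookup xs i *_) (e y)) })
      (form-glue (form-0 {suc n} {0}) (form-coord {d = 0} i (form-const (c zero))))
    where
    +-identityˡ′ : ∀ x a → x * 0ℤ + a ≡ a
    +-identityˡ′ = solve-∀
  form-coord {suc n} {suc d} {f} (suc i) (c , e) =
    form-ext (λ { y@(x ∷ xs) → trans (rearrange x (lookup xs i) _ _) (cong (lookup xs i *_) (e y)) })
      (form-glue (form-coord {d = d} (suc i) (_ , λ y → refl)) (form-coord i (_ , λ y → refl)))
    where
    rearrange : ∀ x y a b → x * (y * a) + y * b ≡ y * (x * a + b)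
    rearrange = solve-∀

  -- More coefficient vectors than dimensions satisfy a nontrivial relation. Evaluated at the
  -- points, it is a triangular system with nonzero diagonal, which kills the relation from the last
  -- entry backwards. Triangular rather than diagonal, because `form-bound` puts in front a form
  -- that vanishes at the later points, while the later forms are not controlled at its point.
  triangular-bound : ∀ n d (ts : List ((Fin (dim n d) → ℤ) × Vec ℤ n)) →
    All (λ (c , y) → eval n d c y ≢ 0ℤ) ts →
    AllPairs (λ (c , _) (_ , y) → eval n d c y ≡ 0ℤ) ts →
    length ts ℕ.≤ dim n d
  triangular-bound n d ts nz tri = ℕₚ.≮⇒≥ λ lt →
    let (b , (j , bj≢0) , rel) = kernel lt (λ i j → proj₁ (List.lookup ts j) i) in
    bj≢0 (vanish ts nz tri b (All.universal (λ (_ , y) →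
      trans (sym (eval-sum n d _ (λ j → proj₁ (List.lookup ts j)) b y)) (eval-0 n d _ rel y)) ts) j)
    where
    vanish : ∀ ts → All (λ (c , y) → eval n d c y ≢ 0ℤ) ts →
      AllPairs (λ (c , _) (_ , y) → eval n d c y ≡ 0ℤ) ts →
      (b : Fin (length ts) → ℤ) →
      All (λ (_ , y) → sumFin (length ts) (λ j → eval n d (proj₁ (List.lookup ts j)) y * b j) ≡ 0ℤ) ts →
      ∀ j → b j ≡ 0ℤ
    vanish ((c , y) ∷ ts) (c≢0 ∷ nz) (c≡0 ∷ tri) b (r ∷ rs) =
      λ { zero → b₀ ; (suc j) → tail j }
      where
      rest : Vec ℤ n → ℤ
      rest z = sumFin (length ts) (λ j → eval n d (proj₁ (List.lookup ts j)) z * b (suc j))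
      tail : ∀ j → b (suc j) ≡ 0ℤ
      tail = vanish ts nz tri (b ∘ suc) (All.map
        (λ {(_ , z)} (e , r′) → trans (sym (trans (cong (λ v → v * b zero + rest z) e) (+-identityˡ (rest z)))) r′)
        (All.zip (c≡0 , rs)))
      rest≡0 : rest y ≡ 0ℤ
      rest≡0 = sum-0 (length ts) λ j →
        let v = eval n d (proj₁ (List.lookup ts j)) y in trans (cong (v *_) (tail j)) (*-zeroʳ v)
      b₀ : b zero ≡ 0ℤ
      b₀ = [ (λ e → contradiction e c≢0) , id ]′ (i*j≡0⇒i≡0∨j≡0 (eval n d c y)
        (trans (sym (trans (cong (eval n d c y * b zero +_) rest≡0) (+-identityʳ _))) r))

  -- Vectors and bilinear forms

  lookup-ext : ∀ {n} {x y : Vec ℤ n} → (∀ i → lookup x i ≡ lookup y i) → x ≡ y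
  lookup-ext {x = x} {y} e =
    trans (sym (Vecₚ.tabulate∘lookup x)) (trans (Vecₚ.tabulate-cong e) (Vecₚ.tabulate∘lookup y))

  lookup-zeroVec : ∀ n i → lookup (zeroVec n) i ≡ 0ℤ
  lookup-zeroVec (suc n) zero    = refl
  lookup-zeroVec (suc n) (suc i) = lookup-zeroVec n i

  _≟ᵥ_ : ∀ {n} (x y : Vec ℤ n) → Dec (x ≡ y)
  _≟ᵥ_ = Vecₚ.≡-dec ℤ._≟_

  neg : ∀ {n} → Vec ℤ n → Vec ℤ n
  neg = Vec.map (-_)

  negᵥ-involutive : ∀ {n} (x : Vec ℤ n) → neg (neg x) ≡ x
  negᵥ-involutive []       = refl
  negᵥ-involutive (x ∷ xs) = cong₂ _∷_ (ℤₚ.neg-involutive x) (negᵥ-involutive xs)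

  lin : ∀ {n} → ℤ → Vec ℤ n → ℤ → Vec ℤ n → Vec ℤ n
  lin a x b y = Vec.zipWith (λ p q → a * p + b * q) x y

  lookup-lin : ∀ {n} a (x : Vec ℤ n) b y i → lookup (lin a x b y) i ≡ a * lookup x i + b * lookup y i
  lookup-lin a x b y i = Vecₚ.lookup-zipWith _ i x y

  combination : ∀ {m n} → (Fin m → ℤ) → (Fin m → Vec ℤ n) → Vec ℤ n
  combination {m} c w = Vec.tabulate (λ j → sumFin m (λ i → c i * lookup (w i) j))

  lookup-combination : ∀ {m n} (c : Fin m → ℤ) (w : Fin m → Vec ℤ n) j →
    lookup (combination c w) j ≡ sumFin m (λ i → c i * lookup (w i) j)
  lookup-combination c w j = Vecₚ.lookup∘tabulate _ j

  apply : ∀ {n} → Mat n → Vec ℤ n → Fin n → ℤ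
  apply {n} A x i = sumFin n (λ j → A i j * lookup x j)

  bil : ∀ {n} → Mat n → Vec ℤ n → Vec ℤ n → ℤ
  bil {n} G x y = sumFin n (λ i → sumFin n (λ j → lookup x i * G i j * lookup y j))

  bil-apply : ∀ {n} (G : Mat n) x y → bil G x y ≡ sumFin n (λ i → lookup x i * apply G y i)
  bil-apply {n} G x y = sum-cong n λ i →
    trans (sum-cong n λ j → *-assoc (lookup x i) (G i j) (lookup y j)) (sum-*ˡ n (lookup x i) _)

  bil-linˡ : ∀ {n} (G : Mat n) a x b y z → bil G (lin a x b y) z ≡ a * bil G x z + b * bil G y z
  bil-linˡ {n} G a x b y z = begin
    bil G (lin a x b y) z
      ≡⟨ bil-apply G (lin a x b y) z ⟩
    sumFin n (λ i → lookup (lin a x b y) i * g i)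
      ≡⟨ sum-cong n (λ i → trans (cong (_* g i) (lookup-lin a x b y i)) (dist a (lookup x i) b (lookup y i) (g i))) ⟩
    sumFin n (λ i → a * (lookup x i * g i) + b * (lookup y i * g i))
      ≡⟨ sum-+ n _ _ ⟩
    sumFin n (λ i → a * (lookup x i * g i)) + sumFin n (λ i → b * (lookup y i * g i))
      ≡⟨ cong₂ _+_ (sum-*ˡ n a _) (sum-*ˡ n b _) ⟩
    a * sumFin n (λ i → lookup x i * g i) + b * sumFin n (λ i → lookup y i * g i)
      ≡⟨ cong₂ (λ u v → a * u + b * v) (sym (bil-apply G x z)) (sym (bil-apply G y z)) ⟩
    a * bil G x z + b * bil G y z ∎
    where
    g = apply G z
    dist : ∀ a x b y g → (a * x + b * y) * g ≡ a * (x * g) + b * (y * g)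
    dist = solve-∀

  bil-combinationˡ : ∀ {m n} (G : Mat n) (c : Fin m → ℤ) w z →
    bil G (combination c w) z ≡ sumFin m (λ i → c i * bil G (w i) z)
  bil-combinationˡ {m} {n} G c w z = begin
    bil G (combination c w) z
      ≡⟨ bil-apply G (combination c w) z ⟩
    sumFin n (λ j → lookup (combination c w) j * g j)
      ≡⟨ sum-cong n (λ j → trans (cong (_* g j) (lookup-combination c w j)) (sym (sum-*ʳ m (g j) _))) ⟩
    sumFin n (λ j → sumFin m (λ i → c i * lookup (w i) j * g j))
      ≡⟨ sum-swap n m _ ⟩
    sumFin m (λ i → sumFin n (λ j → c i * lookup (w i) j * g j))
      ≡⟨ sum-cong m (λ i → trans (sum-cong n (λ j → *-assoc (c i) (lookup (w i) j) (g j))) (sum-*ˡ n (c i) _)) ⟩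
    sumFin m (λ i → c i * sumFin n (λ j → lookup (w i) j * g j))
      ≡⟨ sum-cong m (λ i → cong (c i *_) (sym (bil-apply G (w i) z))) ⟩
    sumFin m (λ i → c i * bil G (w i) z) ∎
    where
    g = apply G z

  bil-sym : ∀ {n} (G : Mat n) → Symmetric G → ∀ x y → bil G x y ≡ bil G y x
  bil-sym {n} G s x y = trans (sum-swap n n _) (sum-cong n λ j → sum-cong n λ i →
    trans (cong (λ g → lookup x i * g * lookup y j) (s i j)) (rev (lookup x i) (G j i) (lookup y j)))
    where
    rev : ∀ a b c → a * b * c ≡ c * b * a
    rev = solve-∀

  0<i-j⇒j<i : ∀ i j → 0ℤ ℤ.< i - j → j ℤ.< i
  0<i-j⇒j<i i j lt = subst (ℤ._< i) (+-identityʳ j) (subst (j + 0ℤ ℤ.<_) (cancel i j) (+-monoʳ-< j lt))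
    where
    cancel : ∀ i j → j + (i - j) ≡ i
    cancel = solve-∀

  square-∣∣ : ∀ i → i * i ≡ (ℤ.+ ℤ.∣ i ∣) * (ℤ.+ ℤ.∣ i ∣)
  square-∣∣ (ℤ.+ n)  = refl
  square-∣∣ -[1+ n ] = refl

  *-≢0 : ∀ {i j} → i ≢ 0ℤ → j ≢ 0ℤ → i * j ≢ 0ℤ
  *-≢0 {i} i≢0 j≢0 e = [ i≢0 , j≢0 ]′ (i*j≡0⇒i≡0∨j≡0 i e)

  *-≢0⁻ : ∀ {i j} → i * j ≢ 0ℤ → i ≢ 0ℤ × j ≢ 0ℤ
  *-≢0⁻ {i} {j} ne = (λ e → ne (cong (_* j) e)) , (λ e → ne (trans (cong (i *_) e) (*-zeroʳ i)))

  -- 2m + 1, in the shape in which multiplication by a quadratic form raises the degree.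
  deg : ℕ → ℕ
  deg zero    = 1
  deg (suc m) = suc (suc (deg m))

  module Lattice {n : ℕ} (G : Mat n) (gram : IntegralGram G) where

    B : Vec ℤ n → Vec ℤ n → ℤ
    B = bil G

    B-sym : ∀ x y → B x y ≡ B y x
    B-sym = bil-sym G (proj₁ gram)

    B-linˡ : ∀ a x b y z → B (lin a x b y) z ≡ a * B x z + b * B y z
    B-linˡ = bil-linˡ G

    B-linʳ : ∀ z a x b y → B z (lin a x b y) ≡ a * B z x + b * B z y
    B-linʳ z a x b y = trans (B-sym z (lin a x b y)) (trans (B-linˡ a x b y z)
      (cong₂ (λ u v → a * u + b * v) (B-sym x z) (B-sym y z)))

    Q-lin : ∀ a x b y → Q G (lin a x b y) ≡ a * a * Q G x + (a * b + a * b) * B x y + b * b * Q G y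
    Q-lin a x b y = begin
      Q G (lin a x b y)
        ≡⟨ B-linˡ a x b y (lin a x b y) ⟩
      a * B x (lin a x b y) + b * B y (lin a x b y)
        ≡⟨ cong₂ (λ u v → a * u + b * v) (B-linʳ x a x b y)
             (trans (B-linʳ y a x b y) (cong (λ u → a * u + b * Q G y) (B-sym y x))) ⟩
      a * (a * Q G x + b * B x y) + b * (a * B x y + b * Q G y)
        ≡⟨ expand a b (Q G x) (B x y) (Q G y) ⟩
      a * a * Q G x + (a * b + a * b) * B x y + b * b * Q G y ∎
      where
      expand : ∀ a b p q r → a * (a * p + b * q) + b * (a * q + b * r) ≡ a * a * p + (a * b + a * b) * q + b * b * r
      expand = solve-∀

    neg-lin : ∀ (x : Vec ℤ n) → neg x ≡ lin -1ℤ x 0ℤ x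
    neg-lin x = lookup-ext λ i → trans (Vecₚ.lookup-map i (-_) x)
      (trans (as-lin (lookup x i)) (sym (lookup-lin -1ℤ x 0ℤ x i)))
      where
      as-lin : ∀ a → - a ≡ -1ℤ * a + 0ℤ * a
      as-lin = solve-∀

    B-negˡ : ∀ x y → B (neg x) y ≡ - B x y
    B-negˡ x y = trans (cong (λ z → B z y) (neg-lin x)) (trans (B-linˡ -1ℤ x 0ℤ x y) (simp (B x y)))
      where
      simp : ∀ a → -1ℤ * a + 0ℤ * a ≡ - a
      simp = solve-∀

    B-negʳ : ∀ x y → B x (neg y) ≡ - B x y
    B-negʳ x y = trans (B-sym x (neg y)) (trans (B-negˡ y x) (cong (-_) (B-sym y x)))

    Q-neg : ∀ x → Q G (neg x) ≡ Q G x
    Q-neg x = trans (B-negˡ x (neg x)) (trans (cong (-_) (B-negʳ x x)) (ℤₚ.neg-involutive (Q G x)))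

    B-zeroˡ : ∀ y → B (zeroVec n) y ≡ 0ℤ
    B-zeroˡ y = trans (bil-apply G (zeroVec n) y) (sum-0 n λ i → cong (_* apply G y i) (lookup-zeroVec n i))

    Q≢0⇒≢0 : ∀ {x} → Q G x ≢ 0ℤ → x ≢ zeroVec n
    Q≢0⇒≢0 ne refl = ne (B-zeroˡ (zeroVec n))

    ≢0⇒Q≢0 : ∀ {x} → x ≢ zeroVec n → Q G x ≢ 0ℤ
    ≢0⇒Q≢0 {x} ne e = ℤₚ.<-irrefl (sym e) (proj₂ gram x ne)

    Q≡0⇒≡0 : ∀ {x} → Q G x ≡ 0ℤ → x ≡ zeroVec n
    Q≡0⇒≡0 {x} e = decidable-stable (x ≟ᵥ zeroVec n) (λ ne → ≢0⇒Q≢0 ne e)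

    Q-nat : ∀ x → Q G x ≡ ℤ.+ ℤ.∣ Q G x ∣
    Q-nat x with x ≟ᵥ zeroVec n
    ... | yes refl = trans (B-zeroˡ (zeroVec n)) (cong (λ i → ℤ.+ ℤ.∣ i ∣) (sym (B-zeroˡ (zeroVec n))))
    ... | no x≢0   = sym (0≤i⇒+∣i∣≡i (<⇒≤ (proj₂ gram x x≢0)))

    private
      difference : Vec ℤ n → Vec ℤ n → Vec ℤ n
      difference x y = lin 1ℤ x -1ℤ y

      ≢⇒difference≢0 : ∀ {x y} → x ≢ y → difference x y ≢ zeroVec n
      ≢⇒difference≢0 {x} {y} ne e = ne (lookup-ext λ i → i-j≡0⇒i≡j (lookup x i) (lookup y i)
        (trans (as-lin (lookup x i) (lookup y i)) (trans (sym (lookup-lin 1ℤ x -1ℤ y i))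
          (trans (cong (λ z → lookup z i) e) (lookup-zeroVec n i)))))
        where
        as-lin : ∀ a b → a - b ≡ 1ℤ * a + -1ℤ * b
        as-lin = solve-∀

      B-upper : ∀ {x y a b m} → Q G x ≡ ℤ.+ a → Q G y ≡ ℤ.+ b → x ≢ y → B x y ≡ ℤ.+ m → 2 ℕ.* m ℕ.< a ℕ.+ b
      B-upper {x} {y} {a} {b} {m} qx qy ne e =
        drop‿+<+ (0<i-j⇒j<i (ℤ.+ (a ℕ.+ b)) (ℤ.+ (2 ℕ.* m)) (subst (0ℤ ℤ.<_) value (proj₂ gram _ (≢⇒difference≢0 ne))))
        where
        simp : ∀ p q r → 1ℤ * 1ℤ * p + (1ℤ * -1ℤ + 1ℤ * -1ℤ) * q + -1ℤ * -1ℤ * r ≡ (p + r) - (q + (q + 0ℤ))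
        simp = solve-∀
        value : Q G (difference x y) ≡ ℤ.+ (a ℕ.+ b) - ℤ.+ (2 ℕ.* m)
        value = trans (Q-lin 1ℤ x -1ℤ y) (trans (simp (Q G x) (B x y) (Q G y))
          (cong₂ _-_ (trans (cong₂ _+_ qx qy) (sym (pos-+ a b)))
            (trans (cong (λ q → q + (q + 0ℤ)) e) (sym (trans (pos-+ m (m ℕ.+ 0)) (cong (ℤ.+ m +_) (pos-+ m 0)))))))

    -- Positive definiteness at x ± y replaces the Cauchy–Schwarz inequality.
    ∣B∣-bound : ∀ {x y a b} → Q G x ≡ ℤ.+ a → Q G y ≡ ℤ.+ b → x ≢ y → x ≢ neg y →
      2 ℕ.* ℤ.∣ B x y ∣ ℕ.< a ℕ.+ b
    ∣B∣-bound {x} {y} qx qy x≢y x≢-y = go (B x y) refl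
      where
      go : ∀ i → B x y ≡ i → 2 ℕ.* ℤ.∣ i ∣ ℕ.< _
      go (ℤ.+ m)  e = B-upper qx qy x≢y e
      go -[1+ m ] e = B-upper qx (trans (Q-neg y) qy) x≢-y (trans (B-negʳ x y) (cong (-_) e))

    ∣B∣<k : ∀ {x y k} → Q G x ≡ ℤ.+ k → Q G y ≡ ℤ.+ k → x ≢ y → x ≢ neg y → ℤ.∣ B x y ∣ ℕ.< k
    ∣B∣<k {x} {y} {k} qx qy ne ne′ = ℕₚ.*-cancelˡ-< 2 ℤ.∣ B x y ∣ k
      (subst (2 ℕ.* ℤ.∣ B x y ∣ ℕ.<_) (cong (k ℕ.+_) (sym (ℕₚ.+-identityʳ k))) (∣B∣-bound qx qy ne ne′))

    -- Orthogonality to m vectors is a system of m homogeneous linear equations in n integral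
    -- unknowns.
    orthogonal-vector : ∀ {m} → m ℕ.< n → (w : Fin m → Vec ℤ n) →
      ∃ λ a → a ≢ zeroVec n × (∀ i → B (w i) a ≡ 0ℤ)
    orthogonal-vector m<n w =
      let (c , (j , cj≢0) , rel) = kernel m<n (λ i → apply G (w i))
          a = Vec.tabulate c
          look = Vecₚ.lookup∘tabulate c in
      a , (λ e → cj≢0 (trans (sym (look j)) (trans (cong (λ z → lookup z j) e) (lookup-zeroVec n j)))) ,
      λ i → trans (B-sym (w i) a) (trans (bil-apply G a (w i))
        (trans (sum-cong n λ j → trans (cong (_* apply G (w i) j) (look j)) (*-comm (c j) _)) (rel i)))

    -- A linear relation paired with `w j` leaves the single term `c j * Q G (w j)`, so every
    -- coefficient vanishes.
    orthogonal-bound : ∀ {m} (w : Fin m → Vec ℤ n) → (∀ i → Q G (w i) ≢ 0ℤ) →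
      (∀ i j → i ≢ j → B (w i) (w j) ≡ 0ℤ) → m ℕ.≤ n
    orthogonal-bound {m} w nz orth = ℕₚ.≮⇒≥ λ n<m →
      let (c , (j , cj≢0) , rel) = kernel n<m (λ l i → lookup (w i) l)
          c·w≡0 : combination c w ≡ zeroVec n
          c·w≡0 = lookup-ext λ l → trans (lookup-combination c w l)
            (trans (sum-cong m λ i → *-comm (c i) _) (trans (rel l) (sym (lookup-zeroVec n l)))) in
      *-≢0 cj≢0 (nz j) (begin
        c j * Q G (w j)
          ≡⟨ sym (sum-single m (λ i → c i * B (w i) (w j)) j
               λ i i≢j → trans (cong (c i *_) (orth i j i≢j)) (*-zeroʳ (c i))) ⟩
        sumFin m (λ i → c i * B (w i) (w j))
          ≡⟨ sym (bil-combinationˡ G c w (w j)) ⟩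
        B (combination c w) (w j)
          ≡⟨ trans (cong (λ z → B z (w j)) c·w≡0) (B-zeroˡ (w j)) ⟩
        0ℤ ∎)

    form-B : ∀ {d f} r → IsForm n d f → IsForm n (suc d) (λ y → B r y * f y)
    form-B {d} {f} r h = form-ext
      (λ y → trans (sum-cong n λ i → sym (*-assoc (lookup y i) (apply G r i) (f y)))
        (trans (sum-*ʳ n (f y) _) (cong (_* f y) (trans (sym (bil-apply G y r)) (B-sym y r)))))
      (form-sum n λ i → form-coord i (form-* (apply G r i) h))

    form-B₁ : ∀ r → IsForm n 1 (B r)
    form-B₁ r = form-ext (λ y → *-identityʳ (B r y)) (form-B r (form-const 1ℤ))

    form-Q : ∀ {d f} → IsForm n d f → IsForm n (suc (suc d)) (λ y → Q G y * f y)
    form-Q {d} {f} h = form-ext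
      (λ y → trans (sum-cong n λ i →
          trans (cong (lookup y i *_) (trans (sum-cong n λ j → move (lookup y j) (G i j) (f y)) (sum-*ʳ n (f y) _)))
            (sym (*-assoc (lookup y i) (apply G y i) (f y))))
        (trans (sum-*ʳ n (f y) _) (cong (_* f y) (sym (bil-apply G y y)))))
      (form-sum n λ i → form-coord i (form-sum n λ j → form-coord j (form-* (G i j) h)))
      where
      move : ∀ y g f → y * (g * f) ≡ g * y * f
      move = solve-∀

  -- Vectors of norm k

  _≁_ : ∀ {n} → Vec ℤ n → Vec ℤ n → Set
  x ≁ y = x ≢ y × x ≢ neg y

  ≁-sym : ∀ {n} {x y : Vec ℤ n} → x ≁ y → y ≁ x
  ≁-sym (x≢y , x≢-y) = x≢y ∘ sym , λ e → x≢-y (trans (sym (negᵥ-involutive _)) (cong neg (sym e)))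

  allPairs-∈ : ∀ {A : Set} {R : A → A → Set} {xs v w} → AllPairs R xs → v ∈ xs → w ∈ xs → v ≡ w ⊎ R v w ⊎ R w v
  allPairs-∈ (r ∷ rs) (here refl) (here refl) = inj₁ refl
  allPairs-∈ (r ∷ rs) (here refl) (there q)   = inj₂ (inj₁ (All.lookup r q))
  allPairs-∈ (r ∷ rs) (there p)   (here refl) = inj₂ (inj₂ (All.lookup r p))
  allPairs-∈ (r ∷ rs) (there p)   (there q)   = allPairs-∈ rs p q

  all⇒allPairs : ∀ {A : Set} {P : A → Set} {R : A → A → Set} {xs} →
    (∀ {x y} → P x → P y → R x y) → All P xs → AllPairs R xs
  all⇒allPairs f []       = []
  all⇒allPairs f (p ∷ ps) = All.map (f p) ps ∷ all⇒allPairs f ps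

  length-split : ∀ {A : Set} {P : A → Set} (P? : ∀ x → Dec (P x)) xs →
    length xs ≡ length (List.filter P? xs) ℕ.+ length (List.filter (¬? ∘ P?) xs)
  length-split P? []       = refl
  length-split P? (x ∷ xs) with P? x
  ... | yes _ = cong suc (length-split P? xs)
  ... | no  _ = trans (cong suc (length-split P? xs)) (sym (ℕₚ.+-suc _ _))

  -- Its sign tells a nonzero vector from its negative, which selects one member of each pair ± x.
  leading : ∀ {n} → Vec ℤ n → ℤ
  leading []       = 0ℤ
  leading (x ∷ xs) with x ℤ.≟ 0ℤ
  ... | yes _ = leading xs
  ... | no  _ = x

  leading≡0 : ∀ {n} (x : Vec ℤ n) → leading x ≡ 0ℤ → x ≡ zeroVec n
  leading≡0 []       e = refl
  leading≡0 (x ∷ xs) e with x ℤ.≟ 0ℤ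
  ... | yes refl = cong (0ℤ ∷_) (leading≡0 xs e)
  ... | no x≢0   = contradiction e x≢0

  leading-neg : ∀ {n} (x : Vec ℤ n) → leading (neg x) ≡ - leading x
  leading-neg []       = refl
  leading-neg (x ∷ xs) with x ℤ.≟ 0ℤ | (- x) ℤ.≟ 0ℤ
  ... | yes _    | yes _   = leading-neg xs
  ... | no  _    | no  _   = refl
  ... | yes refl | no -x≢0 = contradiction refl -x≢0
  ... | no x≢0   | yes -x≡0 = contradiction (trans (sym (ℤₚ.neg-involutive x)) (cong (-_) -x≡0)) x≢0

  half-bound : ∀ {a b m} → a ℕ.+ b ≡ 2 ℕ.* m → m ℕ.≤ a ⊎ m ℕ.≤ b
  half-bound {a} {b} {m} e with m ℕ.≤? a
  ... | yes m≤a = inj₁ m≤a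
  ... | no m≰a  = inj₂ (ℕₚ.≮⇒≥ λ b<m → ℕₚ.<-irrefl e
          (subst (a ℕ.+ b ℕ.<_) (cong (m ℕ.+_) (sym (ℕₚ.+-identityʳ m))) (ℕₚ.+-mono-< (ℕₚ.≰⇒> m≰a) b<m)))

  module Shell {n : ℕ} (G : Mat n) (gram : IntegralGram G) (k′ : ℕ) where

    open Lattice G gram public

    k : ℕ
    k = suc k′

    OnShell : Vec ℤ n → Set
    OnShell x = Q G x ≡ ℤ.+ k

    -- Equality in the bound, with one vector kept from each pair ± x. That every vector of the
    -- shell occurs up to sign is not demanded; `complete` derives it from the length.
    HalfShell : List (Vec ℤ n) → Set
    HalfShell P = All OnShell P × AllPairs _≁_ P × length P ≡ dim n (deg k′)

    factor : Vec ℤ n → ℕ → Vec ℤ n → ℤ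
    factor r j y = ℤ.+ k * (B r y * B r y) - ℤ.+ j * ℤ.+ j * Q G y

    -- On the shell this is a multiple of the product of (⟨r,y⟩ − j) over |j| ≤ m, made homogeneous by Q.
    zonal : Vec ℤ n → ℕ → Vec ℤ n → ℤ
    zonal r zero    y = B r y
    zonal r (suc m) y = factor r (suc m) y * zonal r m y

    form-zonal : ∀ r m → IsForm n (deg m) (zonal r m)
    form-zonal r zero    = form-B₁ r
    form-zonal r (suc m) = form-ext
      (λ y → collect (ℤ.+ k) (B r y) (ℤ.+ suc m) (Q G y) (zonal r m y))
      (form-+ (form-* (ℤ.+ k) (form-B r (form-B r (form-zonal r m))))
              (form-* (- (ℤ.+ suc m * ℤ.+ suc m)) (form-Q (form-zonal r m))))
      where
      collect : ∀ k b j q h → k * (b * (b * h)) + (- (j * j)) * (q * h) ≡ (k * (b * b) - j * j * q) * h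
      collect = solve-∀

    -- The factor with j = |⟨r,x⟩| becomes k j² - j² k. Only `x` has to lie on the shell, so the
    -- form can also be attached to a vector `r` of norm 2.
    zonal≡0 : ∀ {x} r m → OnShell x → ℤ.∣ B r x ∣ ℕ.≤ m → zonal r m x ≡ 0ℤ
    zonal≡0 {x} r zero    qx ∣B∣≤0 = ∣i∣≡0⇒i≡0 (ℕₚ.n≤0⇒n≡0 ∣B∣≤0)
    zonal≡0 {x} r (suc m) qx ∣B∣≤m with ℤ.∣ B r x ∣ ℕ.≟ suc m
    ... | yes ∣B∣≡m = cong (_* zonal r m x) (begin
      ℤ.+ k * (B r x * B r x) - ℤ.+ suc m * ℤ.+ suc m * Q G x
        ≡⟨ cong₂ (λ u v → ℤ.+ k * u - ℤ.+ suc m * ℤ.+ suc m * v)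
             (trans (square-∣∣ (B r x)) (cong (λ i → ℤ.+ i * ℤ.+ i) ∣B∣≡m)) qx ⟩
      ℤ.+ k * (ℤ.+ suc m * ℤ.+ suc m) - ℤ.+ suc m * ℤ.+ suc m * ℤ.+ k
        ≡⟨ cancel (ℤ.+ k) (ℤ.+ suc m * ℤ.+ suc m) ⟩
      0ℤ ∎)
      where
      cancel : ∀ a b → a * b - b * a ≡ 0ℤ
      cancel = solve-∀
    ... | no ∣B∣≢m = trans
      (cong (factor r (suc m) x *_) (zonal≡0 r m qx (ℕₚ.≤-pred (ℕₚ.≤∧≢⇒< ∣B∣≤m ∣B∣≢m))))
      (*-zeroʳ (factor r (suc m) x))

    zonal≢0 : ∀ {x} r m → OnShell x → m ℕ.< ℤ.∣ B r x ∣ → zonal r m x ≢ 0ℤ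
    zonal≢0 {x} r zero    qx m<∣B∣ e = ℕₚ.<-irrefl (sym (cong ℤ.∣_∣ e)) m<∣B∣
    zonal≢0 {x} r (suc m) qx m<∣B∣ = *-≢0 factor≢0 (zonal≢0 r m qx (ℕₚ.<-trans (ℕₚ.n<1+n m) m<∣B∣))
      where
      factor≢0 : factor r (suc m) x ≢ 0ℤ
      factor≢0 e = ℕₚ.<-irrefl refl (ℕₚ.<-≤-trans (ℕₚ.*-mono-< m<∣B∣ m<∣B∣) (ℕₚ.≤-reflexive ∣B∣²≡m²))
        where
        B²≡m² : B r x * B r x ≡ ℤ.+ suc m * ℤ.+ suc m
        B²≡m² = *-cancelˡ-≡ (ℤ.+ k) (B r x * B r x) (ℤ.+ suc m * ℤ.+ suc m)
          (trans (i-j≡0⇒i≡j (ℤ.+ k * (B r x * B r x)) (ℤ.+ suc m * ℤ.+ suc m * Q G x) e)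
            (trans (cong (ℤ.+ suc m * ℤ.+ suc m *_) qx) (*-comm (ℤ.+ suc m * ℤ.+ suc m) (ℤ.+ k))))
        ∣B∣²≡m² : ℤ.∣ B r x ∣ ℕ.* ℤ.∣ B r x ∣ ≡ suc m ℕ.* suc m
        ∣B∣²≡m² = trans (sym (abs-* (B r x) (B r x))) (trans (cong ℤ.∣_∣ B²≡m²) (abs-* (ℤ.+ suc m) (ℤ.+ suc m)))

    -- At y = t r + a with t = k Q(a), the square t² would have to divide j² Q(a) < t².
    zonal-point : ∀ {r a} → r ≢ zeroVec n → a ≢ zeroVec n → B r a ≡ 0ℤ →
      ∃ λ y → B a y ≢ 0ℤ × (∀ m → m ℕ.≤ k′ → zonal r m y ≢ 0ℤ)
    zonal-point {r} {a} r≢0 a≢0 r⊥a = y , Bay≢0 , nonzero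
      where
      s α t : ℕ
      s = ℤ.∣ Q G r ∣
      α = ℤ.∣ Q G a ∣
      t = k ℕ.* α
      y : Vec ℤ n
      y = lin (ℤ.+ t) r 1ℤ a
      s≢0 : s ≢ 0
      s≢0 = ≢0⇒Q≢0 r≢0 ∘ ∣i∣≡0⇒i≡0
      α≢0 : α ≢ 0
      α≢0 = ≢0⇒Q≢0 a≢0 ∘ ∣i∣≡0⇒i≡0
      instance
        _ = ℕ.≢-nonZero s≢0
        _ = ℕ.≢-nonZero α≢0
        t-nonZero : ℕ.NonZero t
        t-nonZero = ℕₚ.m*n≢0 k α
      Bay : B a y ≡ Q G a
      Bay = trans (B-linʳ a (ℤ.+ t) r 1ℤ a)
        (trans (cong (λ u → ℤ.+ t * u + 1ℤ * Q G a) (trans (B-sym a r) r⊥a)) (simp (ℤ.+ t) (Q G a)))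
        where
        simp : ∀ t q → t * 0ℤ + 1ℤ * q ≡ q
        simp = solve-∀
      Bay≢0 : B a y ≢ 0ℤ
      Bay≢0 e = ≢0⇒Q≢0 a≢0 (trans (sym Bay) e)
      Bry : B r y ≡ ℤ.+ (t ℕ.* s)
      Bry = trans (B-linʳ r (ℤ.+ t) r 1ℤ a)
        (trans (cong₂ (λ u v → ℤ.+ t * u + 1ℤ * v) (Q-nat r) r⊥a)
          (trans (+-identityʳ (ℤ.+ t * ℤ.+ s)) (sym (pos-* t s))))
      Qy : Q G y ≡ ℤ.+ (t ℕ.* t ℕ.* s ℕ.+ α)
      Qy = begin
        Q G y
          ≡⟨ Q-lin (ℤ.+ t) r 1ℤ a ⟩
        ℤ.+ t * ℤ.+ t * Q G r + (ℤ.+ t * 1ℤ + ℤ.+ t * 1ℤ) * B r a + 1ℤ * 1ℤ * Q G a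
          ≡⟨ cong (λ u → ℤ.+ t * ℤ.+ t * Q G r + (ℤ.+ t * 1ℤ + ℤ.+ t * 1ℤ) * u + 1ℤ * 1ℤ * Q G a) r⊥a ⟩
        ℤ.+ t * ℤ.+ t * Q G r + (ℤ.+ t * 1ℤ + ℤ.+ t * 1ℤ) * 0ℤ + 1ℤ * 1ℤ * Q G a
          ≡⟨ simp (ℤ.+ t) (Q G r) (Q G a) ⟩
        ℤ.+ t * ℤ.+ t * Q G r + Q G a
          ≡⟨ cong₂ (λ u v → ℤ.+ t * ℤ.+ t * u + v) (Q-nat r) (Q-nat a) ⟩
        ℤ.+ t * ℤ.+ t * ℤ.+ s + ℤ.+ α
          ≡⟨ cong (_+ ℤ.+ α) (sym (trans (pos-* (t ℕ.* t) s) (cong (_* ℤ.+ s) (pos-* t t)))) ⟩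
        ℤ.+ (t ℕ.* t ℕ.* s) + ℤ.+ α
          ≡⟨ sym (pos-+ (t ℕ.* t ℕ.* s) α) ⟩
        ℤ.+ (t ℕ.* t ℕ.* s ℕ.+ α) ∎
        where
        simp : ∀ t p q → t * t * p + (t * 1ℤ + t * 1ℤ) * 0ℤ + 1ℤ * 1ℤ * q ≡ t * t * p + q
        simp = solve-∀
      nonzero : ∀ m → m ℕ.≤ k′ → zonal r m y ≢ 0ℤ
      nonzero zero    _    e = ℕ.≢-nonZero⁻¹ (t ℕ.* s) {{ℕₚ.m*n≢0 t s}} (+-injective (trans (sym Bry) e))
      nonzero (suc m) m<k′ = *-≢0 factor≢0 (nonzero m (ℕₚ.<⇒≤ m<k′))
        where
        j = suc m
        factor≢0 : factor r j y ≢ 0ℤ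
        factor≢0 e = ℕₚ.<⇒≱ j²α<t² (ℕᵈ.∣⇒≤ {{ℕₚ.m*n≢0 (j ℕ.* j) α}} t²∣j²α)
          where
          equation : k ℕ.* ((t ℕ.* s) ℕ.* (t ℕ.* s)) ≡ j ℕ.* j ℕ.* (t ℕ.* t ℕ.* s ℕ.+ α)
          equation = +-injective (begin
            ℤ.+ (k ℕ.* ((t ℕ.* s) ℕ.* (t ℕ.* s)))
              ≡⟨ trans (pos-* k _) (cong (ℤ.+ k *_) (pos-* (t ℕ.* s) (t ℕ.* s))) ⟩
            ℤ.+ k * (ℤ.+ (t ℕ.* s) * ℤ.+ (t ℕ.* s))
              ≡⟨ cong (λ u → ℤ.+ k * (u * u)) (sym Bry) ⟩
            ℤ.+ k * (B r y * B r y)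
              ≡⟨ i-j≡0⇒i≡j _ (ℤ.+ j * ℤ.+ j * Q G y) e ⟩
            ℤ.+ j * ℤ.+ j * Q G y
              ≡⟨ cong₂ _*_ (sym (pos-* j j)) Qy ⟩
            ℤ.+ (j ℕ.* j) * ℤ.+ (t ℕ.* t ℕ.* s ℕ.+ α)
              ≡⟨ sym (pos-* (j ℕ.* j) _) ⟩
            ℤ.+ (j ℕ.* j ℕ.* (t ℕ.* t ℕ.* s ℕ.+ α)) ∎)
          regroup : ∀ k t s → k ℕ.* ((t ℕ.* s) ℕ.* (t ℕ.* s)) ≡ (k ℕ.* s ℕ.* s) ℕ.* (t ℕ.* t)
          regroup = ℕRing.solve-∀
          regroup′ : ∀ j t s a → j ℕ.* j ℕ.* (t ℕ.* t ℕ.* s ℕ.+ a) ≡ (j ℕ.* j ℕ.* s) ℕ.* (t ℕ.* t) ℕ.+ j ℕ.* j ℕ.* a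
          regroup′ = ℕRing.solve-∀
          t²∣j²α : t ℕ.* t ℕᵈ.∣ j ℕ.* j ℕ.* α
          t²∣j²α = ℕᵈ.∣m+n∣m⇒∣n
            (divides (k ℕ.* s ℕ.* s) (trans (sym (regroup′ j t s α)) (trans (sym equation) (regroup k t s))))
            (divides (j ℕ.* j ℕ.* s) refl)
          t²≡ : ∀ k a → k ℕ.* k ℕ.* a ℕ.* a ≡ k ℕ.* a ℕ.* (k ℕ.* a)
          t²≡ = ℕRing.solve-∀
          j²α<t² : j ℕ.* j ℕ.* α ℕ.< t ℕ.* t
          j²α<t² = ℕₚ.<-≤-trans (ℕₚ.*-monoˡ-< α (ℕₚ.*-mono-< (ℕ.s≤s m<k′) (ℕ.s≤s m<k′)))
            (ℕₚ.≤-trans (ℕₚ.m≤m*n (k ℕ.* k ℕ.* α) α) (ℕₚ.≤-reflexive (t²≡ k α)))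

    -- The zonal forms of `P`, each tested at its own vector, are preceded by `p` tested at `y`: as
    -- `p` vanishes on `P`, the longer system is still triangular.
    form-bound : ∀ {P p y} → All OnShell P → AllPairs _≁_ P →
      IsForm n (deg k′) p → p y ≢ 0ℤ → All (λ x → p x ≡ 0ℤ) P → length P ℕ.< dim n (deg k′)
    form-bound {P} {p} {y} shell pairs (c , ev) py≢0 vanish = subst (ℕ._< dim n (deg k′)) (Listₚ.length-map test P)
      (triangular-bound n (deg k′) ((c , y) ∷ List.map test P)
        ((λ e → py≢0 (trans (sym (ev y)) e)) ∷ Allₚ.map⁺ (All.map test≢0 shell))
        (Allₚ.map⁺ (All.map (λ {x} e → trans (ev x) e) vanish) ∷ AllPairsₚ.map⁺ (AllPairs.zipWith
          (λ { ((qx , qy) , (x≢y , x≢-y)) → test≡0 qx qy x≢y x≢-y })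
          (all⇒allPairs _,_ shell , pairs))))
      where
      test : Vec ℤ n → (Fin (dim n (deg k′)) → ℤ) × Vec ℤ n
      test x = proj₁ (form-zonal x k′) , x
      test≢0 : ∀ {x} → OnShell x → eval n (deg k′) (proj₁ (test x)) x ≢ 0ℤ
      test≢0 {x} qx e = zonal≢0 x k′ qx (subst (λ q → k′ ℕ.< ℤ.∣ q ∣) (sym qx) ℕₚ.≤-refl)
        (trans (sym (proj₂ (form-zonal x k′) x)) e)
      test≡0 : ∀ {x y} → OnShell x → OnShell y → x ≢ y → x ≢ neg y → eval n (deg k′) (proj₁ (test x)) y ≡ 0ℤ
      test≡0 {x} {y} qx qy x≢y x≢-y = trans (proj₂ (form-zonal x k′) y)
        (zonal≡0 x k′ qy (ℕₚ.≤-pred (∣B∣<k qx qy x≢y x≢-y)))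

    -- With `P` as long as the dimension there is no room for one more independent form. Searching
    -- the finite list `P` turns this into an actual vector.
    nonvanishing : ∀ {P p y} → HalfShell P → IsForm n (deg k′) p → p y ≢ 0ℤ → ∃ λ x → OnShell x × p x ≢ 0ℤ
    nonvanishing {P} {p} (shell , pairs , len) form py≢0 with Any.any? (λ x → ¬? (p x ℤ.≟ 0ℤ)) P
    ... | yes found = let (x , x∈P , px≢0) = find found in x , All.lookup shell x∈P , px≢0
    ... | no none = contradiction len (ℕₚ.<⇒≢ (form-bound shell pairs form py≢0
          (All.map (λ {x} → decidable-stable (p x ℤ.≟ 0ℤ)) (Allₚ.¬Any⇒All¬ P none))))

    shell≢neg : ∀ {x} → OnShell x → x ≢ neg x
    shell≢neg {x} qx e with trans (sym qx) (trans (cong (B x) e) (trans (B-negʳ x x) (cong (-_) qx)))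
    ... | ()

    complete : ∀ {P} → HalfShell P → NumEq G k (2 ℕ.* dim n (deg k′))
    complete {P} (shell , pairs , len) = P± , length± , unique± , λ x → mk⇔ (sound x) (member x)
      where
      P± = P List.++ List.map neg P
      length± : length P± ≡ 2 ℕ.* dim n (deg k′)
      length± = trans (Listₚ.length-++ P) (trans (cong₂ ℕ._+_ len (trans (Listₚ.length-map neg P) len))
        (cong (dim n (deg k′) ℕ.+_) (sym (ℕₚ.+-identityʳ _))))
      unique± : Unique P±
      unique± = Uniqueₚ.++⁺ uniqueP
        (Uniqueₚ.map⁺ (λ e → trans (sym (negᵥ-involutive _)) (trans (cong neg e) (negᵥ-involutive _))) uniqueP)
        λ { (v∈P , v∈-P) → opposite v∈P (∈-map⁻ neg v∈-P) }
        where
        uniqueP : Unique P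
        uniqueP = AllPairs.map proj₁ pairs
        opposite : ∀ {v} → v ∈ P → ¬ (∃ λ w → w ∈ P × v ≡ neg w)
        opposite v∈P (w , w∈P , refl) with allPairs-∈ pairs v∈P w∈P
        ... | inj₁ e = shell≢neg (All.lookup shell w∈P) (sym e)
        ... | inj₂ (inj₁ (_ , ne)) = ne refl
        ... | inj₂ (inj₂ (_ , ne)) = ne (sym (negᵥ-involutive w))
      sound : ∀ x → x ∈ P± → OnShell x
      sound x x∈ with ∈-++⁻ P x∈
      ... | inj₁ x∈P = All.lookup shell x∈P
      ... | inj₂ x∈-P = let (w , w∈P , e) = ∈-map⁻ neg x∈-P in
            trans (cong (Q G) e) (trans (Q-neg w) (All.lookup shell w∈P))
      member : ∀ x → OnShell x → x ∈ P±
      -- A vector outside the list would add its own zonal form, nonzero at itself and zero on `P`.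
      member x qx = decidable-stable (x ∈? P±) λ x∉ →
        ℕₚ.<⇒≢ (form-bound shell pairs (form-zonal x k′)
          (zonal≢0 {x} x k′ qx (subst (λ q → k′ ℕ.< ℤ.∣ q ∣) (sym qx) ℕₚ.≤-refl))
          (All.tabulate λ {y} y∈P → zonal≡0 {y} x k′ (All.lookup shell y∈P)
            (ℕₚ.≤-pred (∣B∣<k {x} {y} qx (All.lookup shell y∈P)
              (λ { refl → x∉ (∈-++⁺ˡ y∈P) })
              (λ { refl → x∉ (∈-++⁺ʳ P (∈-map⁺ neg y∈P)) }))))) len
        where open DecMembership (_≟ᵥ_ {n}) using (_∈?_)

    -- Instead of matching opposite vectors, the list is split by the sign of `leading`. Neither
    -- part contains an opposite pair, one of them has at least half of the vectors, and it is cut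
    -- down to the exact length.
    halve : NumEq G k (2 ℕ.* dim n (deg k′)) → ∃ HalfShell
    halve (X , len , unique , spec) =
      [ choose positive? (λ _ _ → positive≢) , choose (¬? ∘ positive?) nonpositive≢ ]′
      (half-bound (trans (sym (length-split positive? X)) len))
      where
      positive? : (x : Vec ℤ n) → Dec (0ℤ ℤ.< leading x)
      positive? x = 0ℤ ℤ.<? leading x
      positive≢ : ∀ {x y : Vec ℤ n} → 0ℤ ℤ.< leading x → 0ℤ ℤ.< leading y → x ≢ neg y
      positive≢ {x} {y} p q e = <-asym p (subst (ℤ._< 0ℤ) (sym (trans (cong leading e) (leading-neg y))) (neg-mono-< q))
      nonpositive≢ : ∀ {x y : Vec ℤ n} → OnShell x → OnShell y →
        ¬ (0ℤ ℤ.< leading x) → ¬ (0ℤ ℤ.< leading y) → x ≢ neg y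
      nonpositive≢ {x} {y} qx qy p q e = Q≢0⇒≢0 (λ z → contradiction (trans (sym qy) z) λ ())
        (leading≡0 y (≤-antisym (≮⇒≥ q) (subst (0ℤ ℤ.≤_) (ℤₚ.neg-involutive (leading y)) (neg-mono-≤
          (subst (ℤ._≤ 0ℤ) (trans (cong leading e) (leading-neg y)) (≮⇒≥ p))))))
      choose : ∀ {S : Vec ℤ n → Set} (S? : ∀ x → Dec (S x)) →
        (∀ {x y} → OnShell x → OnShell y → S x → S y → x ≢ neg y) →
        dim n (deg k′) ℕ.≤ length (List.filter S? X) → ∃ HalfShell
      choose S? sep le = List.take N Y ,
        Allₚ.take⁺ N shell ,
        AllPairsₚ.take⁺ N (AllPairs.zipWith id (Uniqueₚ.filter⁺ S? unique ,
          all⇒allPairs (λ (q , s) (q′ , s′) → sep q q′ s s′) (All.zip (shell , Allₚ.all-filter S? X)))) ,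
        trans (Listₚ.length-take N Y) (ℕₚ.m≤n⇒m⊓n≡m le)
        where
        N = dim n (deg k′)
        Y = List.filter S? X
        shell : All OnShell Y
        shell = Allₚ.filter⁺ S? (All.tabulate λ {x} → Equivalence.to (spec x))

  -- Matrices and isometries

  idMat-diag : ∀ {n} (i : Fin n) → idMat i i ≡ 1ℤ
  idMat-diag i with i Fin.≟ i
  ... | yes _  = refl
  ... | no i≢i = contradiction refl i≢i

  idMat-off : ∀ {n} {i j : Fin n} → i ≢ j → idMat i j ≡ 0ℤ
  idMat-off {i = i} {j} i≢j with i Fin.≟ j
  ... | yes i≡j = contradiction i≡j i≢j
  ... | no  _   = refl

  idMat-sum : ∀ {n} (f : Fin n → ℤ) i → sumFin n (λ j → idMat i j * f j) ≡ f i
  idMat-sum {n} f i = trans (sum-single n (λ j → idMat i j * f j) i λ j j≢i → cong (_* f j) (idMat-off (j≢i ∘ sym)))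
    (trans (cong (_* f i) (idMat-diag i)) (*-identityˡ (f i)))

  ·-assoc : ∀ {n} (A B C : Mat n) i j → ((A · B) · C) i j ≡ (A · (B · C)) i j
  ·-assoc {n} A B C i j = begin
    sumFin n (λ l → sumFin n (λ m → A i m * B m l) * C l j)
      ≡⟨ sum-cong n (λ l → trans (sym (sum-*ʳ n (C l j) (λ m → A i m * B m l))) (sum-cong n λ m → *-assoc (A i m) (B m l) (C l j))) ⟩
    sumFin n (λ l → sumFin n (λ m → A i m * (B m l * C l j)))
      ≡⟨ sum-swap n n _ ⟩
    sumFin n (λ m → sumFin n (λ l → A i m * (B m l * C l j)))
      ≡⟨ sum-cong n (λ m → sum-*ˡ n (A i m) _) ⟩
    sumFin n (λ m → A i m * sumFin n (λ l → B m l * C l j)) ∎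

  -- A linear relation between the unit vector e_j and the columns of U has, after applying V, coefficients
  -- proportional to the j-th column of V.
  left⇒right-inverse : ∀ {n} (U V : Mat n) →
    (∀ i j → (V · U) i j ≡ idMat i j) → ∀ i j → (U · V) i j ≡ idMat i j
  left⇒right-inverse {n} U V VU≡I i j = *-cancelˡ-≡ c₀ ((U · V) i j) (idMat i j) {{ℤ.≢-nonZero c₀≢0}}
    (sym (i-j≡0⇒i≡j (c₀ * idMat i j) (c₀ * (U · V) i j) (trans (sym lhs) (rel i))))
    where
    A : Fin n → Fin (suc n) → ℤ
    A l zero    = idMat l j
    A l (suc m) = U l m
    ker = kernel (ℕₚ.n<1+n n) A
    c : Fin (suc n) → ℤ
    c = proj₁ ker
    c₀ = c zero
    rel : ∀ l → sumFin (suc n) (λ m → A l m * c m) ≡ 0ℤ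
    rel = proj₂ (proj₂ ker)
    c-tail : ∀ m → c (suc m) ≡ - (c₀ * V m j)
    c-tail m = negate (c₀ * V m j) (c (suc m)) (begin
      c₀ * V m j + c (suc m)
        ≡⟨ cong₂ _+_ (trans (*-comm c₀ (V m j)) (cong (_* c₀) (sym V·e))) (sym (trans
             (sum-cong n λ l → cong (_* c (suc l)) (VU≡I m l)) (idMat-sum (c ∘ suc) m))) ⟩
      sumFin n (λ l → V m l * idMat l j) * c₀ + sumFin n (λ l → (V · U) m l * c (suc l))
        ≡⟨ cong₂ _+_ (sym (sum-*ʳ n c₀ _)) (trans (sum-cong n λ l → sym (sum-*ʳ n (c (suc l)) _)) (sum-swap n n _)) ⟩
      sumFin n (λ l → V m l * idMat l j * c₀) + sumFin n (λ l → sumFin n (λ p → V m l * U l p * c (suc p)))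
        ≡⟨ sym (sum-+ n _ _) ⟩
      sumFin n (λ l → V m l * idMat l j * c₀ + sumFin n (λ p → V m l * U l p * c (suc p)))
        ≡⟨ sum-0 n (λ l → begin
             V m l * idMat l j * c₀ + sumFin n (λ p → V m l * U l p * c (suc p))
               ≡⟨ cong₂ _+_ (*-assoc (V m l) (idMat l j) c₀)
                    (trans (sum-cong n λ p → *-assoc (V m l) (U l p) (c (suc p))) (sum-*ˡ n (V m l) _)) ⟩
             V m l * (idMat l j * c₀) + V m l * sumFin n (λ p → U l p * c (suc p))
               ≡⟨ sym (*-distribˡ-+ (V m l) _ _) ⟩
             V m l * (idMat l j * c₀ + sumFin n (λ p → U l p * c (suc p)))
               ≡⟨ trans (cong (V m l *_) (rel l)) (*-zeroʳ (V m l)) ⟩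
             0ℤ ∎) ⟩
      0ℤ ∎)
      where
      V·e : sumFin n (λ l → V m l * idMat l j) ≡ V m j
      V·e = trans (sum-single n (λ l → V m l * idMat l j) j λ l l≢j → trans (cong (V m l *_) (idMat-off l≢j)) (*-zeroʳ (V m l)))
        (trans (cong (V m j *_) (idMat-diag j)) (*-identityʳ (V m j)))
      negate : ∀ a b → a + b ≡ 0ℤ → b ≡ - a
      negate a b e = trans (add-sub a b) (trans (cong (_- a) e) (+-identityˡ (- a)))
        where
        add-sub : ∀ a b → b ≡ (a + b) - a
        add-sub = solve-∀
    c₀≢0 : c₀ ≢ 0ℤ
    c₀≢0 e with proj₁ (proj₂ ker)
    ... | zero  , ne = ne e
    ... | suc m , ne = ne (trans (c-tail m) (cong (λ v → - (v * V m j)) e))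
    lhs : sumFin (suc n) (λ m → A i m * c m) ≡ c₀ * idMat i j - c₀ * (U · V) i j
    lhs = cong₂ _+_ (*-comm (idMat i j) c₀) (begin
      sumFin n (λ m → U i m * c (suc m))
        ≡⟨ sum-cong n (λ m → trans (cong (U i m *_) (c-tail m)) (move (U i m) c₀ (V m j))) ⟩
      sumFin n (λ m → - c₀ * (U i m * V m j))
        ≡⟨ sum-*ˡ n (- c₀) _ ⟩
      - c₀ * (U · V) i j
        ≡⟨ sym (neg-distribˡ-* c₀ _) ⟩
      - (c₀ * (U · V) i j) ∎)
      where
      move : ∀ u c v → u * (- (c * v)) ≡ - c * (u * v)
      move = solve-∀

  column : ∀ {n} → Mat n → Fin n → Vec ℤ n
  column U j = Vec.tabulate (λ i → U i j)

  congruence-bil : ∀ {n} (G U : Mat n) i j → ((transpose U · G) · U) i j ≡ bil G (column U i) (column U j)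
  congruence-bil {n} G U i j = begin
    sumFin n (λ l → sumFin n (λ m → U m i * G m l) * U l j)
      ≡⟨ sum-cong n (λ l → sym (sum-*ʳ n (U l j) _)) ⟩
    sumFin n (λ l → sumFin n (λ m → U m i * G m l * U l j))
      ≡⟨ sum-swap n n _ ⟩
    sumFin n (λ m → sumFin n (λ l → U m i * G m l * U l j))
      ≡⟨ sum-cong n (λ m → sum-cong n λ l → cong₂ (λ a b → a * G m l * b)
           (sym (Vecₚ.lookup∘tabulate (λ p → U p i) m)) (sym (Vecₚ.lookup∘tabulate (λ p → U p j) l))) ⟩
    bil G (column U i) (column U j) ∎

  -- Vectors with a unimodular Gram matrix already generate the lattice: from Uᵀ G U = H and W H =
  -- I, the integral matrix W Uᵀ G is a left inverse of U.
  isometric-from-basis : ∀ {n} (G H W : Mat n) (w : Fin n → Vec ℤ n) →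
    (∀ i j → bil G (w i) (w j) ≡ H i j) → (∀ i j → (W · H) i j ≡ idMat i j) → Isometric G H
  isometric-from-basis {n} G H W w gramw WH≡I = U , V , left⇒right-inverse U V VU≡I , UGU
    where
    U V : Mat n
    U i j = lookup (w j) i
    V = W · (transpose U · G)
    UGU : ∀ i j → ((transpose U · G) · U) i j ≡ H i j
    UGU i j = trans (congruence-bil G U i j)
      (trans (cong₂ (bil G) (Vecₚ.tabulate∘lookup (w i)) (Vecₚ.tabulate∘lookup (w j))) (gramw i j))
    VU≡I : ∀ i j → (V · U) i j ≡ idMat i j
    VU≡I i j = trans (·-assoc W (transpose U · G) U i j)
      (trans (sum-cong n λ l → cong (W i l *_) (UGU l j)) (WH≡I i j))

  module Transfer {n : ℕ} {G H : Mat n} (gram : IntegralGram G) (iso : Isometric G H) where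

    private
      module L = Lattice G gram
      U V : Mat n
      U = proj₁ iso
      V = proj₁ (proj₂ iso)
      UV≡I = proj₁ (proj₂ (proj₂ iso))
      -- `Isometric` supplies only one of the two inverse identities.
      VU≡I = left⇒right-inverse V U UV≡I

    image preimage : Vec ℤ n → Vec ℤ n
    image    x = Vec.tabulate (apply U x)
    preimage x = Vec.tabulate (apply V x)

    private
      apply-inverse : ∀ (A B : Mat n) → (∀ i j → (A · B) i j ≡ idMat i j) →
        ∀ x → Vec.tabulate (apply A (Vec.tabulate (apply B x))) ≡ x
      apply-inverse A B AB≡I x = lookup-ext λ i → begin
        lookup (Vec.tabulate (apply A (Vec.tabulate (apply B x)))) i
          ≡⟨ Vecₚ.lookup∘tabulate _ i ⟩
        sumFin n (λ j → A i j * lookup (Vec.tabulate (apply B x)) j)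
          ≡⟨ sum-cong n (λ j → trans (cong (A i j *_) (Vecₚ.lookup∘tabulate (apply B x) j))
               (trans (sym (sum-*ˡ n (A i j) _)) (sum-cong n λ l → sym (*-assoc (A i j) (B j l) (lookup x l))))) ⟩
        sumFin n (λ j → sumFin n (λ l → A i j * B j l * lookup x l))
          ≡⟨ sum-swap n n _ ⟩
        sumFin n (λ l → sumFin n (λ j → A i j * B j l * lookup x l))
          ≡⟨ sum-cong n (λ l → trans (sum-*ʳ n (lookup x l) _) (cong (_* lookup x l) (AB≡I i l))) ⟩
        sumFin n (λ l → idMat i l * lookup x l)
          ≡⟨ idMat-sum (lookup x) i ⟩
        lookup x i ∎

      image≡combination : ∀ x → image x ≡ combination (lookup x) (column U)
      image≡combination x = Vecₚ.tabulate-cong λ i → sum-cong n λ j →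
        trans (*-comm (U i j) (lookup x j)) (cong (lookup x j *_) (sym (Vecₚ.lookup∘tabulate (λ p → U p j) i)))

    image-preimage : ∀ x → image (preimage x) ≡ x
    image-preimage = apply-inverse U V UV≡I

    preimage-image : ∀ x → preimage (image x) ≡ x
    preimage-image = apply-inverse V U VU≡I

    bil-column : ∀ i j → L.B (column U i) (column U j) ≡ H i j
    bil-column i j = trans (sym (congruence-bil G U i j)) (proj₂ (proj₂ (proj₂ iso)) i j)

    Q-image : ∀ x → Q G (image x) ≡ Q H x
    Q-image x = begin
      Q G (image x)
        ≡⟨ cong (Q G) (image≡combination x) ⟩
      L.B xw xw
        ≡⟨ bil-combinationˡ G (lookup x) (column U) xw ⟩
      sumFin n (λ i → lookup x i * L.B (column U i) xw)
        ≡⟨ sum-cong n (λ i → cong (lookup x i *_) (trans (L.B-sym (column U i) xw)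
             (trans (bil-combinationˡ G (lookup x) (column U) (column U i))
               (sum-cong n λ j → trans (cong (lookup x j *_)
                 (trans (L.B-sym (column U j) (column U i)) (bil-column i j))) (*-comm (lookup x j) (H i j)))))) ⟩
      sumFin n (λ i → lookup x i * apply H x i)
        ≡⟨ sym (bil-apply H x x) ⟩
      Q H x ∎
      where
      xw = combination (lookup x) (column U)

    -- Positive definiteness of the standard Gram matrices is inherited from `G` through the
    -- isometry, which spares a direct proof for E8.
    gram′ : IntegralGram H
    gram′ = (λ i j → trans (sym (bil-column i j)) (trans (L.B-sym (column U i) (column U j)) (bil-column j i))) ,
      λ x x≢0 → subst (0ℤ ℤ.<_) (Q-image x) (proj₂ gram (image x) λ e → x≢0 (begin
        x                   ≡⟨ sym (preimage-image x) ⟩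
        preimage (image x)  ≡⟨ cong preimage e ⟩
        preimage (zeroVec n) ≡⟨ lookup-ext (λ i → trans (Vecₚ.lookup∘tabulate _ i)
                                 (trans (sum-0 n λ j → trans (cong (V i j *_) (lookup-zeroVec n j)) (*-zeroʳ (V i j)))
                                        (sym (lookup-zeroVec n i)))) ⟩
        zeroVec n           ∎))

    numEq : ∀ {k c} → NumEq H k c → NumEq G k c
    numEq (xs , len , unique , spec) = List.map image xs , trans (Listₚ.length-map image xs) len ,
      Uniqueₚ.map⁺ (λ {x} {y} e → trans (sym (preimage-image x)) (trans (cong preimage e) (preimage-image y))) unique ,
      λ y → mk⇔
        (λ y∈ → let (x , x∈ , e) = ∈-map⁻ image y∈ in trans (cong (Q G) e) (trans (Q-image x) (Equivalence.to (spec x) x∈)))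
        (λ qy → subst (_∈ List.map image xs) (image-preimage y) (∈-map⁺ image (Equivalence.from (spec (preimage y))
          (trans (sym (Q-image (preimage y))) (trans (cong (Q G) (image-preimage y)) qy)))))

  -- The norms k = 1 and k ≥ 3

  allPairs-lookup : ∀ {A : Set} {R : A → A → Set} {xs} → (∀ {x y} → R x y → R y x) → AllPairs R xs →
    ∀ i j → i ≢ j → R (List.lookup xs i) (List.lookup xs j)
  allPairs-lookup s (r ∷ rs) zero    zero    i≢j = contradiction refl i≢j
  allPairs-lookup s (r ∷ rs) zero    (suc j) i≢j = All.lookup r (∈-lookup j)
  allPairs-lookup s (r ∷ rs) (suc i) zero    i≢j = s (All.lookup r (∈-lookup i))
  allPairs-lookup s (r ∷ rs) (suc i) (suc j) i≢j = allPairs-lookup s rs i j (i≢j ∘ cong suc)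

  dim-1 : ∀ n → dim n 1 ≡ n
  dim-1 zero    = refl
  dim-1 (suc n) = cong suc (dim-1 n)

  dim>0 : ∀ n d → 1 ℕ.≤ n → 1 ℕ.≤ dim n d
  dim>0 (suc n) zero    _   = ℕₚ.≤-refl
  dim>0 (suc n) (suc d) 1≤n = ℕₚ.≤-trans (dim>0 (suc n) d 1≤n) (ℕₚ.m≤m+n _ _)

  -- The degree is 1, so `P` has n members, and |⟨x,y⟩| < 1 makes distinct members orthogonal. Their
  -- Gram matrix is its own inverse, so they form a basis.
  halfShell₁⇒ℤⁿ : ∀ {n} (G : Mat n) (gram : IntegralGram G) {P} → Shell.HalfShell G gram 0 P → Isometric G idMat
  halfShell₁⇒ℤⁿ {n} G gram {P} (shell , pairs , len) =
    isometric-from-basis G idMat idMat w orthonormal (λ i j → idMat-sum (λ l → idMat l j) i)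
    where
    open Shell G gram 0
    index : Fin n → Fin (length P)
    index = Fin.cast (sym (trans len (dim-1 n)))
    w : Fin n → Vec ℤ n
    w i = List.lookup P (index i)
    index-injective : ∀ {i j} → index i ≡ index j → i ≡ j
    index-injective {i} {j} e = Finₚ.toℕ-injective
      (trans (sym (Finₚ.toℕ-cast _ i)) (trans (cong Fin.toℕ e) (Finₚ.toℕ-cast _ j)))
    orthonormal : ∀ i j → B (w i) (w j) ≡ idMat i j
    orthonormal i j with i Fin.≟ j
    ... | yes refl = All.lookup shell (∈-lookup (index i))
    ... | no i≢j   = let (≢+ , ≢-) = allPairs-lookup ≁-sym pairs (index i) (index j) (i≢j ∘ index-injective) in
      ∣i∣≡0⇒i≡0 (ℕₚ.n<1⇒n≡0 (∣B∣<k {w i} {w j}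
        (All.lookup shell (∈-lookup (index i))) (All.lookup shell (∈-lookup (index j))) ≢+ ≢-))

  module ShellFacts {n : ℕ} (G : Mat n) (gram : IntegralGram G) (k′ : ℕ) where

    open Shell G gram k′ public

    shell-vector : ∀ {P} → HalfShell P → 1 ℕ.≤ n → ∃ OnShell
    shell-vector {x ∷ P} (qx ∷ _ , _) _        = x , qx
    shell-vector {[]}    (_ , _ , len) 1≤n = contradiction (dim>0 n (deg k′) 1≤n) (ℕₚ.<⇒≱ (subst (ℕ._< 1) len (ℕ.s≤s z≤n)))

    -- A hyperplane through `y` that misses `x` also misses -x. In this way vectors found by
    -- `nonvanishing` meet the hypotheses of `∣B∣<k`.
    separated : ∀ {a x y} → B a x ≢ 0ℤ → B a y ≡ 0ℤ → x ≁ y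
    separated {a} {x} {y} ax≢0 ay≡0 =
      (λ { refl → ax≢0 ay≡0 }) , λ { refl → ax≢0 (trans (B-negʳ a y) (cong (-_) ay≡0)) }

    OnShell-neg : ∀ {x} → OnShell x → OnShell (neg x)
    OnShell-neg {x} qx = trans (Q-neg x) qx

  -- If |⟨u,x⟩| < k − 1 for all x on the shell other than ± u, then ⟨a,·⟩² times the form of degree 2k − 3
  -- vanishing there vanishes on the whole shell. So u − x has norm 2 for some x, and then the form of degree
  -- 2k − 1 attached to this short vector vanishes on the shell.
  no-halfShell : ∀ {n} (G : Mat n) (gram : IntegralGram G) m → 1 ℕ.≤ m → 2 ℕ.≤ n →
    ∀ {P} → ¬ Shell.HalfShell G gram (suc m) P
  no-halfShell {n} G gram m 1≤m 2≤n half = refute-short (proj₁ short) (proj₂ short)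
    where
    open ShellFacts G gram (suc m)
    u = proj₁ (shell-vector half (ℕₚ.<⇒≤ 2≤n))
    qu : OnShell u
    qu = proj₂ (shell-vector half (ℕₚ.<⇒≤ 2≤n))
    shell≢0 : ∀ {x} → OnShell x → x ≢ zeroVec n
    shell≢0 qx = Q≢0⇒≢0 (λ e → contradiction (trans (sym qx) e) λ ())
    difference : ∀ {x} → OnShell x → B u x ≡ ℤ.+ suc m → ∃ λ r → Q G r ≡ ℤ.+ 2
    difference {x} qx ux = lin 1ℤ x -1ℤ u , (begin
      Q G (lin 1ℤ x -1ℤ u)
        ≡⟨ Q-lin 1ℤ x -1ℤ u ⟩
      1ℤ * 1ℤ * Q G x + (1ℤ * -1ℤ + 1ℤ * -1ℤ) * B x u + -1ℤ * -1ℤ * Q G u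
        ≡⟨ cong₂ (λ p q → 1ℤ * 1ℤ * p + (1ℤ * -1ℤ + 1ℤ * -1ℤ) * q + -1ℤ * -1ℤ * Q G u) qx (trans (B-sym x u) ux) ⟩
      1ℤ * 1ℤ * (ℤ.+ 2 + ℤ.+ m) + (1ℤ * -1ℤ + 1ℤ * -1ℤ) * (1ℤ + ℤ.+ m) + -1ℤ * -1ℤ * Q G u
        ≡⟨ cong (λ p → 1ℤ * 1ℤ * (ℤ.+ 2 + ℤ.+ m) + (1ℤ * -1ℤ + 1ℤ * -1ℤ) * (1ℤ + ℤ.+ m) + -1ℤ * -1ℤ * p) qu ⟩
      1ℤ * 1ℤ * (ℤ.+ 2 + ℤ.+ m) + (1ℤ * -1ℤ + 1ℤ * -1ℤ) * (1ℤ + ℤ.+ m) + -1ℤ * -1ℤ * (ℤ.+ 2 + ℤ.+ m)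
        ≡⟨ simp (ℤ.+ m) ⟩
      ℤ.+ 2 ∎)
      where
      simp : ∀ m → 1ℤ * 1ℤ * (ℤ.+ 2 + m) + (1ℤ * -1ℤ + 1ℤ * -1ℤ) * (1ℤ + m) + -1ℤ * -1ℤ * (ℤ.+ 2 + m) ≡ ℤ.+ 2
      simp = solve-∀
    neighbour : ∃ λ x → OnShell x × ℤ.∣ B u x ∣ ≡ suc m
    neighbour =
      let (a , a≢0 , u⊥a) = orthogonal-vector 2≤n (λ (_ : Fin 1) → u)
          (y , ay≢0 , zy≢0) = zonal-point {u} {a} (shell≢0 {u} qu) a≢0 (u⊥a zero)
          (x , qx , px≢0) = nonvanishing {y = y} half (form-B a (form-B a (form-zonal u m)))
                              (*-≢0 ay≢0 (*-≢0 ay≢0 (zy≢0 m (ℕₚ.n≤1+n m))))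
          (ax≢0 , rest) = *-≢0⁻ {B a x} px≢0
          (≢u , ≢-u) = ≁-sym (separated {a} {x} {u} ax≢0 (trans (B-sym a u) (u⊥a zero)))
      in x , qx , ℕₚ.≤-antisym (ℕₚ.≤-pred (∣B∣<k {u} {x} qu qx ≢u ≢-u))
                    (ℕₚ.≰⇒> λ le → proj₂ (*-≢0⁻ {B a x} rest) (zonal≡0 {x} u m qx le))
    short : ∃ λ r → Q G r ≡ ℤ.+ 2
    short = let (x , qx , ∣ux∣) = neighbour in go x qx (B u x) refl ∣ux∣
      where
      go : ∀ x → OnShell x → ∀ i → B u x ≡ i → ℤ.∣ i ∣ ≡ suc m → ∃ λ r → Q G r ≡ ℤ.+ 2
      go x qx (ℤ.+ j)  e j≡m = difference {x} qx (trans e (cong ℤ.+_ j≡m))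
      go x qx -[1+ j ] e j≡m = difference {neg x} (OnShell-neg {x} qx)
        (trans (B-negʳ u x) (trans (cong (-_) e) (cong ℤ.+_ j≡m)))
    refute-short : ∀ r → Q G r ≡ ℤ.+ 2 → ⊥
    refute-short r qr =
      let (a , a≢0 , r⊥a) = orthogonal-vector 2≤n (λ (_ : Fin 1) → r)
          (y , _ , zy≢0) = zonal-point {r} {a} (Q≢0⇒≢0 (λ e → contradiction (trans (sym qr) e) λ ())) a≢0 (r⊥a zero)
          (x , qx , zx≢0) = nonvanishing {y = y} half (form-zonal r (suc m)) (zy≢0 (suc m) ℕₚ.≤-refl)
      in zx≢0 (zonal≡0 {x} r (suc m) qx (ℕₚ.≤-pred (bound x qx)))
      where
      -- Here k ≥ 3 is essential: x ≠ ± r since the norms k and 2 differ, and then 2|⟨r,x⟩| < 2 + k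
      -- ≤ 2k.
      bound : ∀ x → OnShell x → ℤ.∣ B r x ∣ ℕ.< k
      bound x qx = ℕₚ.*-cancelˡ-< 2 ℤ.∣ B r x ∣ k (ℕₚ.<-≤-trans
        (∣B∣-bound {r} {x} qr qx (λ e → norms≢ (trans (cong (Q G) (sym e)) qr))
          (λ e → norms≢ (trans (sym (Q-neg x)) (trans (cong (Q G) (sym e)) qr))))
        (ℕₚ.≤-trans (ℕₚ.+-monoˡ-≤ k (ℕ.s≤s (ℕ.s≤s z≤n))) (ℕₚ.≤-reflexive (cong (k ℕ.+_) (sym (ℕₚ.+-identityʳ k))))))
        where
        norms≢ : Q G x ≢ ℤ.+ 2
        norms≢ e = ℕₚ.<-irrefl (sym (+-injective (trans (sym qx) e))) (ℕ.s≤s (ℕ.s≤s 1≤m))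

  -- The norm k = 2

  -- All that the root-system argument knows of the lattice. Extremality enters through `root` and
  -- `generic-root` alone, and `B`, being a field, does not unfold into sums over a Gram matrix.
  record RootLattice (n : ℕ) : Set where
    field
      B : Vec ℤ n → Vec ℤ n → ℤ
      B-sym : ∀ x y → B x y ≡ B y x
      B-linˡ : ∀ a x b y z → B (lin a x b y) z ≡ a * B x z + b * B y z
      B-combinationˡ : ∀ {m} (c : Fin m → ℤ) w z → B (combination c w) z ≡ sumFin m (λ i → c i * B (w i) z)
      B-negʳ : ∀ x y → B x (neg y) ≡ - B x y
      B-null : ∀ {x} → B x x ≡ 0ℤ → ∀ y → B x y ≡ 0ℤ
      orthogonal-vector : ∀ {m} → m ℕ.< n → (w : Fin m → Vec ℤ n) →
        ∃ λ a → B a a ≢ 0ℤ × (∀ i → B (w i) a ≡ 0ℤ)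
      orthogonal-bound : ∀ {m} (w : Fin m → Vec ℤ n) → (∀ i → B (w i) (w i) ≢ 0ℤ) →
        (∀ i j → i ≢ j → B (w i) (w j) ≡ 0ℤ) → m ℕ.≤ n
      root-bound : ∀ {x y} → B x x ≡ ℤ.+ 2 → B y y ≡ ℤ.+ 2 → x ≁ y → ℤ.∣ B x y ∣ ℕ.< 2
      root : ∃ λ x → B x x ≡ ℤ.+ 2
      generic-root : ∀ {a b c} → B a a ≢ 0ℤ → B b b ≢ 0ℤ → B c c ≢ 0ℤ →
        ∃ λ x → B x x ≡ ℤ.+ 2 × B a x ≢ 0ℤ × B b x ≢ 0ℤ × B c x ≢ 0ℤ

  -- The possible inner products of two roots that are not equal or opposite.
  data Trit : ℤ → Set where
    t₀ : Trit 0ℤ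
    t₊ : Trit 1ℤ
    t₋ : Trit -1ℤ

  trit : ∀ i → ℤ.∣ i ∣ ℕ.< 2 → Trit i
  trit (ℤ.+ 0)  _ = t₀
  trit (ℤ.+ 1)  _ = t₊
  trit -[1+ 0 ] _ = t₋
  trit (ℤ.+ suc (suc _)) (s≤s (s≤s ()))
  trit -[1+ suc _ ]      (s≤s (s≤s ()))

  -- In this table and the next two, p and q are the products of a root x with eᵢ + eⱼ and eᵢ - eⱼ,
  -- so that p + q = 2xᵢ and p - q = 2xⱼ.
  trits-sum-2 : ∀ {p q} → Trit p → Trit q → p + q ≡ ℤ.+ 2 → p - q ≡ 0ℤ
  trits-sum-2 t₊ t₊ _ = refl
  trits-sum-2 t₀ t₀ ()
  trits-sum-2 t₀ t₊ ()
  trits-sum-2 t₀ t₋ ()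
  trits-sum-2 t₊ t₀ ()
  trits-sum-2 t₊ t₋ ()
  trits-sum-2 t₋ t₀ ()
  trits-sum-2 t₋ t₊ ()
  trits-sum-2 t₋ t₋ ()

  trits-odd : ∀ {p q} → Trit p → Trit q → (p + q) * (p + q) ≡ 1ℤ → (p - q) * (p - q) ≡ 1ℤ
  trits-odd t₀ t₊ _ = refl
  trits-odd t₀ t₋ _ = refl
  trits-odd t₊ t₀ _ = refl
  trits-odd t₋ t₀ _ = refl
  trits-odd t₀ t₀ ()
  trits-odd t₊ t₊ ()
  trits-odd t₊ t₋ ()
  trits-odd t₋ t₊ ()
  trits-odd t₋ t₋ ()

  trits-nonzero : ∀ {p q} → Trit p → Trit q → p + q ≢ 0ℤ → p - q ≢ 0ℤ → (p + q) * (p + q) ≡ 1ℤ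
  trits-nonzero t₀ t₀ s d = contradiction refl s
  trits-nonzero t₀ t₊ s d = refl
  trits-nonzero t₀ t₋ s d = refl
  trits-nonzero t₊ t₀ s d = refl
  trits-nonzero t₊ t₊ s d = contradiction refl d
  trits-nonzero t₊ t₋ s d = contradiction refl s
  trits-nonzero t₋ t₀ s d = refl
  trits-nonzero t₋ t₊ s d = contradiction refl s
  trits-nonzero t₋ t₋ s d = contradiction refl d

  -- Writes a sign s as 1 + 2h, so that flipping a vector v is adding 2h v.
  sign-half : ∀ s → s * s ≡ 1ℤ → ∃ λ h → s ≡ 1ℤ + ℤ.+ 2 * h
  sign-half (ℤ.+ 1)            _ = 0ℤ , refl
  sign-half -[1+ 0 ]           _ = -1ℤ , refl
  sign-half (ℤ.+ 0)            ()
  sign-half (ℤ.+ suc (suc _))  ()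
  sign-half -[1+ suc _ ]       ()

  halve-≡ : ∀ {i j} → ℤ.+ 2 * i ≡ ℤ.+ 2 * j → i ≡ j
  halve-≡ {i} {j} = *-cancelˡ-≡ (ℤ.+ 2) i j

  module Roots {n : ℕ} (L : RootLattice n) where

    open RootLattice L

    IsRoot : Vec ℤ n → Set
    IsRoot x = B x x ≡ ℤ.+ 2

    B-linʳ : ∀ z a x b y → B z (lin a x b y) ≡ a * B z x + b * B z y
    B-linʳ z a x b y = trans (B-sym z (lin a x b y)) (trans (B-linˡ a x b y z)
      (cong₂ (λ u v → a * u + b * v) (B-sym x z) (B-sym y z)))

    norm-lin : ∀ {x y p q r} a b → B x x ≡ p → B x y ≡ q → B y y ≡ r →
      B (lin a x b y) (lin a x b y) ≡ a * (a * p + b * q) + b * (a * q + b * r)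
    norm-lin {x} {y} a b refl refl refl = trans (B-linˡ a x b y (lin a x b y))
      (cong₂ (λ u v → a * u + b * v) (B-linʳ x a x b y)
        (trans (B-linʳ y a x b y) (cong (λ u → a * u + b * B y y) (B-sym y x))))

    separated : ∀ {a x y} → B a x ≢ 0ℤ → B a y ≡ 0ℤ → x ≁ y
    separated {a} {x} {y} ax≢0 ay≡0 =
      (λ { refl → ax≢0 ay≡0 }) , λ { refl → ax≢0 (trans (B-negʳ a y) (cong (-_) ay≡0)) }

    root-trit : ∀ {r x} → IsRoot r → IsRoot x → x ≁ r → Trit (B r x)
    root-trit {r} {x} qr qx ne = trit (B r x) (root-bound qr qx (≁-sym ne))

    root-neg : ∀ {x} → IsRoot x → IsRoot (neg x)
    root-neg {x} qx = begin
      B (neg x) (neg x)  ≡⟨ B-negʳ (neg x) x ⟩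
      - B (neg x) x      ≡⟨ cong (-_) (trans (B-sym (neg x) x) (B-negʳ x x)) ⟩
      - - B x x          ≡⟨ ℤₚ.neg-involutive (B x x) ⟩
      B x x              ≡⟨ qx ⟩
      ℤ.+ 2              ∎

    root≢0 : ∀ {x} → IsRoot x → B x x ≢ 0ℤ
    root≢0 qx e with trans (sym qx) e
    ... | ()

    -- A root x orthogonal neither to r nor to some a ⊥ r is not ± r, hence ⟨r,x⟩ = ± 1, and a sign
    -- change gives -1. Passing `a` twice brings the degree up to three.
    adjacent-roots : 2 ℕ.≤ n → ∃ λ r → ∃ λ s → IsRoot r × IsRoot s × B r s ≡ -1ℤ
    adjacent-roots 2≤n with root
    ... | r , qr with orthogonal-vector 2≤n (λ (_ : Fin 1) → r)
    ... | a , a≢0 , r⊥a with generic-root (root≢0 qr) a≢0 a≢0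
    ... | x , qx , rx≢0 , ax≢0 , _ =
      orient qr qx rx≢0 (root-trit qr qx (separated ax≢0 (trans (B-sym a r) (r⊥a zero)))) refl
      where
      orient : ∀ {r x i} → IsRoot r → IsRoot x → B r x ≢ 0ℤ → Trit i → B r x ≡ i →
        ∃ λ r → ∃ λ s → IsRoot r × IsRoot s × B r s ≡ -1ℤ
      orient         qr qx ne t₀ e = contradiction e ne
      orient {r} {x} qr qx ne t₊ e = r , neg x , qr , root-neg qx , trans (B-negʳ r x) (cong (-_) e)
      orient {r} {x} qr qx ne t₋ e = r , x , qr , qx , e

    -- The three forms below vanish, one each, on the three pairs of roots of the A₂ system spanned by r and s.
    orthogonal-roots : 2 ℕ.≤ n → ∃ λ r → ∃ λ s → IsRoot r × IsRoot s × B r s ≡ 0ℤ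
    orthogonal-roots 2≤n with adjacent-roots 2≤n
    ... | r , s , qr , qs , rs with generic-root
            (subst (_≢ 0ℤ) (sym (norm-lin {r} {s} (ℤ.+ 2) 1ℤ qr rs qs)) λ ())
            (subst (_≢ 0ℤ) (sym (norm-lin {r} {s} -1ℤ 1ℤ qr rs qs)) λ ())
            (subst (_≢ 0ℤ) (sym (norm-lin {r} {s} 1ℤ (ℤ.+ 2) qr rs qs)) λ ())
    ... | x , qx , ax≢0 , bx≢0 , cx≢0 =
      select qr qs rs qx (root-trit qr qx x≁r) refl (root-trit qs qx x≁s) refl
        (subst (_≢ 0ℤ) (B-linˡ -1ℤ r 1ℤ s x) bx≢0)
      where
      x≁r : x ≁ r
      x≁r = separated cx≢0 (trans (B-linˡ 1ℤ r (ℤ.+ 2) s r)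
        (cong₂ (λ u v → 1ℤ * u + ℤ.+ 2 * v) qr (trans (B-sym s r) rs)))
      x≁s : x ≁ s
      x≁s = separated ax≢0 (trans (B-linˡ (ℤ.+ 2) r 1ℤ s s) (cong₂ (λ u v → ℤ.+ 2 * u + 1ℤ * v) rs qs))
      -- The form of s - r excludes p = q. So p or q is 0, or they are opposite and x is orthogonal
      -- to the root r + s.
      select : ∀ {r s x p q} → IsRoot r → IsRoot s → B r s ≡ -1ℤ → IsRoot x →
        Trit p → B r x ≡ p → Trit q → B s x ≡ q → -1ℤ * B r x + 1ℤ * B s x ≢ 0ℤ →
        ∃ λ r → ∃ λ s → IsRoot r × IsRoot s × B r s ≡ 0ℤ
      select {r} {s} {x} qr qs rs qx t₀ p t  q ne = r , x , qr , qx , p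
      select {r} {s} {x} qr qs rs qx t₊ p t₀ q ne = s , x , qs , qx , q
      select {r} {s} {x} qr qs rs qx t₋ p t₀ q ne = s , x , qs , qx , q
      select {r} {s} {x} qr qs rs qx t₊ p t₊ q ne = contradiction (cong₂ (λ u v → -1ℤ * u + 1ℤ * v) p q) ne
      select {r} {s} {x} qr qs rs qx t₋ p t₋ q ne = contradiction (cong₂ (λ u v → -1ℤ * u + 1ℤ * v) p q) ne
      select {r} {s} {x} qr qs rs qx t₊ p t₋ q ne = lin 1ℤ r 1ℤ s , x , norm-lin 1ℤ 1ℤ qr rs qs , qx ,
        trans (B-linˡ 1ℤ r 1ℤ s x) (cong₂ (λ u v → 1ℤ * u + 1ℤ * v) p q)
      select {r} {s} {x} qr qs rs qx t₋ p t₊ q ne = lin 1ℤ r 1ℤ s , x , norm-lin 1ℤ 1ℤ qr rs qs , qx ,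
        trans (B-linˡ 1ℤ r 1ℤ s x) (cong₂ (λ u v → 1ℤ * u + 1ℤ * v) p q)

    -- A root system of type D_m with orthonormal coordinates eᵢ: w i is 2eᵢ and mid i j is eᵢ + eⱼ.
    record Frame (m : ℕ) : Set where
      field
        w       : Fin m → Vec ℤ n
        mid     : Fin m → Fin m → Vec ℤ n
        w-norm  : ∀ i → B (w i) (w i) ≡ ℤ.+ 4
        w-orth  : ∀ i j → i ≢ j → B (w i) (w j) ≡ 0ℤ
        mid-B   : ∀ i j z → ℤ.+ 2 * B (mid i j) z ≡ B (w i) z + B (w j) z

      -- The vector eᵢ - eⱼ, reached without halves as (eᵢ + eⱼ) - 2eⱼ.
      dif : Fin m → Fin m → Vec ℤ n
      dif i j = lin 1ℤ (mid i j) -1ℤ (w j)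

      mid-wˡ : ∀ {i j} → i ≢ j → B (mid i j) (w i) ≡ ℤ.+ 2
      mid-wˡ {i} {j} i≢j = halve-≡ (trans (mid-B i j (w i)) (cong₂ _+_ (w-norm i) (w-orth j i (i≢j ∘ sym))))

      mid-wʳ : ∀ {i j} → i ≢ j → B (mid i j) (w j) ≡ ℤ.+ 2
      mid-wʳ {i} {j} i≢j = halve-≡ (trans (mid-B i j (w j)) (cong₂ _+_ (w-orth i j i≢j) (w-norm j)))

      mid-⊥ : ∀ {i j z} → B (w i) z ≡ 0ℤ → B (w j) z ≡ 0ℤ → B (mid i j) z ≡ 0ℤ
      mid-⊥ {i} {j} {z} wi wj = halve-≡ (trans (mid-B i j z) (cong₂ _+_ wi wj))

      dif-⊥ : ∀ {i j z} → B (w i) z ≡ 0ℤ → B (w j) z ≡ 0ℤ → B (dif i j) z ≡ 0ℤ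
      dif-⊥ {i} {j} {z} wi wj =
        trans (B-linˡ 1ℤ (mid i j) -1ℤ (w j) z) (cong₂ (λ u v → 1ℤ * u + -1ℤ * v) (mid-⊥ wi wj) wj)

      mid-root : ∀ {i j} → i ≢ j → IsRoot (mid i j)
      mid-root {i} {j} i≢j = halve-≡ (trans (mid-B i j (mid i j))
        (cong₂ _+_ (trans (B-sym (w i) (mid i j)) (mid-wˡ i≢j)) (trans (B-sym (w j) (mid i j)) (mid-wʳ i≢j))))

      dif-root : ∀ {i j} → i ≢ j → IsRoot (dif i j)
      dif-root {i} {j} i≢j = norm-lin 1ℤ -1ℤ (mid-root i≢j) (mid-wʳ i≢j) (w-norm j)

      mid-dif : ∀ {i j} → i ≢ j → B (mid i j) (dif i j) ≡ 0ℤ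
      mid-dif {i} {j} i≢j = trans (B-linʳ (mid i j) 1ℤ (mid i j) -1ℤ (w j))
        (cong₂ (λ u v → 1ℤ * u + -1ℤ * v) (mid-root i≢j) (mid-wʳ i≢j))

      wˡ-split : ∀ i j x → B (w i) x ≡ B (mid i j) x + B (dif i j) x
      wʳ-split : ∀ i j x → B (w j) x ≡ B (mid i j) x - B (dif i j) x
      wʳ-split i j x = trans (isolate (B (mid i j) x) (B (w j) x))
        (cong (λ u → B (mid i j) x - u) (sym (B-linˡ 1ℤ (mid i j) -1ℤ (w j) x)))
        where
        isolate : ∀ p q → q ≡ p - (1ℤ * p + -1ℤ * q)
        isolate = solve-∀
      wˡ-split i j x = begin
        B (w i) x
          ≡⟨ isolate (B (w i) x) (B (w j) x) ⟩
        (B (w i) x + B (w j) x) - B (w j) x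
          ≡⟨ cong₂ _-_ (sym (mid-B i j x)) (wʳ-split i j x) ⟩
        ℤ.+ 2 * B (mid i j) x - (B (mid i j) x - B (dif i j) x)
          ≡⟨ simp (B (mid i j) x) (B (dif i j) x) ⟩
        B (mid i j) x + B (dif i j) x ∎
        where
        isolate : ∀ p q → p ≡ (p + q) - q
        isolate = solve-∀
        simp : ∀ p q → ℤ.+ 2 * p - (p - q) ≡ p + q
        simp = solve-∀

    open Frame

    -- Read r as e₀ + e₁ and s as e₀ - e₁; then 2e₀ = r + s and 2e₁ = r - s.
    frame₂ : ∀ {r s} → IsRoot r → IsRoot s → B r s ≡ 0ℤ → Frame 2
    frame₂ {r} {s} qr qs rs = record
      { w = v ; mid = c ; w-norm = norm ; w-orth = orth ; mid-B = mid-v }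
      where
      v : Fin 2 → Vec ℤ n
      v zero       = lin 1ℤ r 1ℤ s
      v (suc zero) = lin 1ℤ r -1ℤ s
      c : Fin 2 → Fin 2 → Vec ℤ n
      c zero       zero       = v zero
      c (suc zero) (suc zero) = v (suc zero)
      c zero       (suc zero) = r
      c (suc zero) zero       = r
      norm : ∀ i → B (v i) (v i) ≡ ℤ.+ 4
      norm zero       = norm-lin {r} {s} 1ℤ 1ℤ qr rs qs
      norm (suc zero) = norm-lin {r} {s} 1ℤ -1ℤ qr rs qs
      v₀v₁ : B (v zero) (v (suc zero)) ≡ 0ℤ
      v₀v₁ = trans (B-linˡ 1ℤ r 1ℤ s (v (suc zero))) (cong₂ (λ a b → 1ℤ * a + 1ℤ * b)
        (trans (B-linʳ r 1ℤ r -1ℤ s) (cong₂ (λ a b → 1ℤ * a + -1ℤ * b) qr rs))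
        (trans (B-linʳ s 1ℤ r -1ℤ s) (cong₂ (λ a b → 1ℤ * a + -1ℤ * b) (trans (B-sym s r) rs) qs)))
      orth : ∀ i j → i ≢ j → B (v i) (v j) ≡ 0ℤ
      orth zero       zero       i≢j = contradiction refl i≢j
      orth zero       (suc zero) _   = v₀v₁
      orth (suc zero) zero       _   = trans (B-sym (v (suc zero)) (v zero)) v₀v₁
      orth (suc zero) (suc zero) i≢j = contradiction refl i≢j
      double : ∀ a → ℤ.+ 2 * a ≡ a + a
      double = solve-∀
      r-mid : ∀ z → ℤ.+ 2 * B r z ≡ B (v zero) z + B (v (suc zero)) z
      r-mid z = trans (simp (B r z) (B s z)) (sym (cong₂ _+_ (B-linˡ 1ℤ r 1ℤ s z) (B-linˡ 1ℤ r -1ℤ s z)))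
        where
        simp : ∀ a b → ℤ.+ 2 * a ≡ (1ℤ * a + 1ℤ * b) + (1ℤ * a + -1ℤ * b)
        simp = solve-∀
      mid-v : ∀ i j z → ℤ.+ 2 * B (c i j) z ≡ B (v i) z + B (v j) z
      mid-v zero       zero       z = double (B (v zero) z)
      mid-v (suc zero) (suc zero) z = double (B (v (suc zero)) z)
      mid-v zero       (suc zero) z = r-mid z
      mid-v (suc zero) zero       z = trans (r-mid z) (+-comm (B (v zero) z) _)

    -- Such a root is x = eᵢ + e with e a new unit vector orthogonal to the frame, and 2e = 2x -
    -- 2eᵢ.
    extend : ∀ {m x} (F : Frame m) i → IsRoot x → B (w F i) x ≡ ℤ.+ 2 →
      (∀ j → j ≢ i → B (w F j) x ≡ 0ℤ) → Frame (suc m)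
    extend {m} {x} F i qx wᵢx wⱼx = record
      { w = v ; mid = c ; w-norm = norm ; w-orth = orth ; mid-B = mid-v }
      where
      new : Vec ℤ n
      new = lin (ℤ.+ 2) x -1ℤ (w F i)
      v : Fin (suc m) → Vec ℤ n
      v zero    = new
      v (suc j) = w F j
      -- The midpoint e + eⱼ, as (eᵢ + e) + (eⱼ - eᵢ).
      bridge : Fin m → Vec ℤ n
      bridge j = lin 1ℤ x 1ℤ (lin 1ℤ (mid F i j) -1ℤ (w F i))
      c : Fin (suc m) → Fin (suc m) → Vec ℤ n
      c zero    zero    = new
      c zero    (suc j) = bridge j
      c (suc j) zero    = bridge j
      c (suc j) (suc l) = mid F j l
      norm : ∀ j → B (v j) (v j) ≡ ℤ.+ 4
      norm zero    = norm-lin (ℤ.+ 2) -1ℤ qx (trans (B-sym x (w F i)) wᵢx) (w-norm F i)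
      norm (suc j) = w-norm F j
      new-w : ∀ j → B new (w F j) ≡ 0ℤ
      new-w j with j Fin.≟ i
      ... | yes refl = trans (B-linˡ (ℤ.+ 2) x -1ℤ (w F i) (w F i))
        (cong₂ (λ a b → ℤ.+ 2 * a + -1ℤ * b) (trans (B-sym x (w F i)) wᵢx) (w-norm F i))
      ... | no j≢i = trans (B-linˡ (ℤ.+ 2) x -1ℤ (w F i) (w F j))
        (cong₂ (λ a b → ℤ.+ 2 * a + -1ℤ * b) (trans (B-sym x (w F j)) (wⱼx j j≢i)) (w-orth F i j (j≢i ∘ sym)))
      orth : ∀ j l → j ≢ l → B (v j) (v l) ≡ 0ℤ
      orth zero    zero    j≢l = contradiction refl j≢l
      orth zero    (suc l) _   = new-w l
      orth (suc j) zero    _   = trans (B-sym (w F j) new) (new-w j)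
      orth (suc j) (suc l) j≢l = w-orth F j l (j≢l ∘ cong suc)
      double : ∀ a → ℤ.+ 2 * a ≡ a + a
      double = solve-∀
      bridge-B : ∀ j z → ℤ.+ 2 * B (bridge j) z ≡ B new z + B (w F j) z
      bridge-B j z = begin
        ℤ.+ 2 * B (bridge j) z
          ≡⟨ cong (ℤ.+ 2 *_) (trans (B-linˡ 1ℤ x 1ℤ (lin 1ℤ (mid F i j) -1ℤ (w F i)) z)
               (cong (λ u → 1ℤ * B x z + 1ℤ * u) (B-linˡ 1ℤ (mid F i j) -1ℤ (w F i) z))) ⟩
        ℤ.+ 2 * (1ℤ * B x z + 1ℤ * (1ℤ * B (mid F i j) z + -1ℤ * B (w F i) z))
          ≡⟨ regroup (B x z) (B (mid F i j) z) (B (w F i) z) ⟩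
        (ℤ.+ 2 * B x z + -1ℤ * B (w F i) z) + (ℤ.+ 2 * B (mid F i j) z - B (w F i) z)
          ≡⟨ cong₂ (λ a b → a + (b - B (w F i) z)) (sym (B-linˡ (ℤ.+ 2) x -1ℤ (w F i) z)) (mid-B F i j z) ⟩
        B new z + (B (w F i) z + B (w F j) z - B (w F i) z)
          ≡⟨ cong (B new z +_) (cancel (B (w F i) z) (B (w F j) z)) ⟩
        B new z + B (w F j) z ∎
        where
        regroup : ∀ a b c → ℤ.+ 2 * (1ℤ * a + 1ℤ * (1ℤ * b + -1ℤ * c)) ≡ (ℤ.+ 2 * a + -1ℤ * c) + (ℤ.+ 2 * b - c)
        regroup = solve-∀
        cancel : ∀ a b → a + b - a ≡ b
        cancel = solve-∀
      mid-v : ∀ j l z → ℤ.+ 2 * B (c j l) z ≡ B (v j) z + B (v l) z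
      mid-v zero    zero    z = double (B new z)
      mid-v zero    (suc l) z = bridge-B l z
      mid-v (suc j) zero    z = trans (bridge-B j z) (+-comm (B new z) (B (w F j) z))
      mid-v (suc j) (suc l) z = mid-B F j l z

    -- Up to the sign of x, a root not orthogonal to e₀ + e₁ and e₀ − e₁ is e₀ or e₁ plus a vector orthogonal to both.
    Oriented : ∀ {m} → Frame (suc (suc m)) → Vec ℤ n → Set
    Oriented F x = ∃ λ x′ → IsRoot x′ × (∀ a → B a x ≢ 0ℤ → B a x′ ≢ 0ℤ) ×
        ((B (w F zero) x′ ≡ ℤ.+ 2 × B (w F (suc zero)) x′ ≡ 0ℤ) ⊎ (B (w F zero) x′ ≡ 0ℤ × B (w F (suc zero)) x′ ≡ ℤ.+ 2))

    orient : ∀ {m} (F : Frame (suc (suc m))) {x} → IsRoot x →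
      B (mid F zero (suc zero)) x ≢ 0ℤ → B (dif F zero (suc zero)) x ≢ 0ℤ →
      x ≁ mid F zero (suc zero) → x ≁ dif F zero (suc zero) →
      Oriented F x
    orient F {x} qx mx≢0 dx≢0 x≁m x≁d =
      go (root-trit (mid-root F 0≢1) qx x≁m) refl (root-trit (dif-root F 0≢1) qx x≁d) refl
      where
      0≢1 : zero ≢ suc zero
      0≢1 ()
      w₀ w₁ : Vec ℤ n
      w₀ = w F zero
      w₁ = w F (suc zero)
      w₀x : ∀ {p q} → B (mid F zero (suc zero)) x ≡ p → B (dif F zero (suc zero)) x ≡ q → B w₀ x ≡ p + q
      w₀x e f = trans (wˡ-split F zero (suc zero) x) (cong₂ _+_ e f)
      w₁x : ∀ {p q} → B (mid F zero (suc zero)) x ≡ p → B (dif F zero (suc zero)) x ≡ q → B w₁ x ≡ p - q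
      w₁x e f = trans (wʳ-split F zero (suc zero) x) (cong₂ _-_ e f)
      flip : ∀ {a i} → B a x ≡ i → B a (neg x) ≡ - i
      flip {a} e = trans (B-negʳ a x) (cong (-_) e)
      flip≢0 : ∀ a → B a x ≢ 0ℤ → B a (neg x) ≢ 0ℤ
      flip≢0 a ne e = ne (trans (sym (ℤₚ.neg-involutive (B a x))) (cong (-_) (trans (sym (B-negʳ a x)) e)))
      go : ∀ {p q} → Trit p → B (mid F zero (suc zero)) x ≡ p → Trit q → B (dif F zero (suc zero)) x ≡ q → Oriented F x
      go t₀ e _  f = contradiction e mx≢0
      go _  e t₀ f = contradiction f dx≢0
      go t₊ e t₊ f = x , qx , (λ a → id) , inj₁ (w₀x e f , w₁x e f)
      go t₊ e t₋ f = x , qx , (λ a → id) , inj₂ (w₀x e f , w₁x e f)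
      go t₋ e t₊ f = neg x , root-neg qx , flip≢0 , inj₂ (flip (w₀x e f) , flip (w₁x e f))
      go t₋ e t₋ f = neg x , root-neg qx , flip≢0 , inj₁ (flip (w₀x e f) , flip (w₁x e f))

    -- Separate from `grow`, because n > 2 is not yet known and no vector orthogonal to the frame
    -- can be called upon. With two coordinates, e₀ + e₁ and e₀ - e₁ are orthogonal to each other,
    -- which already keeps x off both; the third slot repeats the first.
    frame₃ : Frame 2 → Frame 3
    frame₃ F = finish (orient F qx mx≢0 dx≢0
        (separated dx≢0 (trans (B-sym (dif F zero (suc zero)) (mid F zero (suc zero))) (mid-dif F 0≢1)))
        (separated mx≢0 (mid-dif F 0≢1)))
      where
      0≢1 : zero ≢ suc zero
      0≢1 ()
      found = generic-root (root≢0 (mid-root F 0≢1)) (root≢0 (dif-root F 0≢1)) (root≢0 (mid-root F 0≢1))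
      x = proj₁ found
      qx : IsRoot x
      qx = proj₁ (proj₂ found)
      mx≢0 : B (mid F zero (suc zero)) x ≢ 0ℤ
      mx≢0 = proj₁ (proj₂ (proj₂ found))
      dx≢0 : B (dif F zero (suc zero)) x ≢ 0ℤ
      dx≢0 = proj₁ (proj₂ (proj₂ (proj₂ found)))
      finish : Oriented F x → Frame 3
      finish (x′ , qx′ , _ , inj₁ (e , f)) = extend F zero qx′ e
        λ { zero j≢i → contradiction refl j≢i ; (suc zero) _ → f }
      finish (x′ , qx′ , _ , inj₂ (e , f)) = extend F (suc zero) qx′ f
        λ { zero _ → e ; (suc zero) j≢i → contradiction refl j≢i }

    -- As `a` is orthogonal to the frame, ⟨a,x⟩ ≠ 0 keeps x off all eᵢ ± eⱼ. Once xᵢ = 1, the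
    -- products with eᵢ + eⱼ and eᵢ - eⱼ must both be 1, so that xⱼ = 0 for every other j.
    grow : ∀ {m} → suc (suc m) ℕ.< n → Frame (suc (suc m)) → Frame (suc (suc (suc m)))
    grow {m} m<n F = finish (orient F qx mx≢0 dx≢0 (avoid-mid ax≢0 zero (suc zero)) (avoid-dif ax≢0 zero (suc zero)))
      where
      0≢1 : _≢_ {A = Fin (suc (suc m))} zero (suc zero)
      0≢1 ()
      perp = orthogonal-vector m<n (w F)
      a = proj₁ perp
      w⊥a : ∀ i → B (w F i) a ≡ 0ℤ
      w⊥a = proj₂ (proj₂ perp)
      found = generic-root (root≢0 (mid-root F 0≢1)) (root≢0 (dif-root F 0≢1)) (proj₁ (proj₂ perp))
      x = proj₁ found
      qx : IsRoot x
      qx = proj₁ (proj₂ found)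
      mx≢0 : B (mid F zero (suc zero)) x ≢ 0ℤ
      mx≢0 = proj₁ (proj₂ (proj₂ found))
      dx≢0 : B (dif F zero (suc zero)) x ≢ 0ℤ
      dx≢0 = proj₁ (proj₂ (proj₂ (proj₂ found)))
      ax≢0 : B a x ≢ 0ℤ
      ax≢0 = proj₂ (proj₂ (proj₂ (proj₂ found)))
      avoid-mid : ∀ {x} → B a x ≢ 0ℤ → ∀ i j → x ≁ mid F i j
      avoid-mid ne i j = separated ne (trans (B-sym a (mid F i j)) (mid-⊥ F (w⊥a i) (w⊥a j)))
      avoid-dif : ∀ {x} → B a x ≢ 0ℤ → ∀ i j → x ≁ dif F i j
      avoid-dif ne i j = separated ne (trans (B-sym a (dif F i j)) (dif-⊥ F (w⊥a i) (w⊥a j)))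
      others : ∀ {x} i → IsRoot x → B a x ≢ 0ℤ → B (w F i) x ≡ ℤ.+ 2 → ∀ j → j ≢ i → B (w F j) x ≡ 0ℤ
      others {x} i qx ne e j j≢i = trans (wʳ-split F i j x) (trits-sum-2
        (root-trit (mid-root F (j≢i ∘ sym)) qx (avoid-mid ne i j))
        (root-trit (dif-root F (j≢i ∘ sym)) qx (avoid-dif ne i j))
        (trans (sym (wˡ-split F i j x)) e))
      finish : Oriented F x → Frame (suc (suc (suc m)))
      finish (x′ , qx′ , keep , inj₁ (e , _)) = extend F zero qx′ e (others zero qx′ (keep a ax≢0) e)
      finish (x′ , qx′ , keep , inj₂ (_ , f)) = extend F (suc zero) qx′ f (others (suc zero) qx′ (keep a ax≢0) f)

    frame-bound : ∀ {m} → Frame m → m ℕ.≤ n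
    frame-bound F = orthogonal-bound (w F) (λ i e → contradiction (trans (sym (w-norm F i)) e) λ ()) (w-orth F)

    -- The index m + 3 retains the three coordinates that `spinor` needs; the climb ends because
    -- orthogonal frames have at most n members.
    full-frame : 2 ℕ.≤ n → ∃ λ m → suc (suc (suc m)) ≡ n × Frame (suc (suc (suc m)))
    full-frame 2≤n = climb n 0 (ℕₚ.m≤m+n n 3) (frame₃ (start (orthogonal-roots 2≤n)))
      where
      start : (∃ λ r → ∃ λ s → IsRoot r × IsRoot s × B r s ≡ 0ℤ) → Frame 2
      start (_ , _ , qr , qs , rs) = frame₂ qr qs rs
      climb : ∀ fuel m → n ℕ.≤ fuel ℕ.+ suc (suc (suc m)) → Frame (suc (suc (suc m))) →
        ∃ λ m → suc (suc (suc m)) ≡ n × Frame (suc (suc (suc m)))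
      climb zero    m le F = m , ℕₚ.≤-antisym (frame-bound F) le , F
      climb (suc f) m le F with suc (suc (suc m)) ℕ.<? n
      ... | yes m<n = climb f (suc m) (subst (n ℕ.≤_) (sym (ℕₚ.+-suc f (suc (suc (suc m))))) le) (grow m<n F)
      ... | no m≮n  = m , ℕₚ.≤-antisym (frame-bound F) (ℕₚ.≮⇒≥ m≮n) , F

    -- Replaces eᵢ by sᵢeᵢ. The new midpoint sᵢeᵢ + sⱼeⱼ is (eᵢ + eⱼ) + hᵢ(2eᵢ) + hⱼ(2eⱼ), so it
    -- stays in the lattice.
    flip-frame : ∀ {m} (F : Frame m) (s h : Fin m → ℤ) → (∀ i → s i * s i ≡ 1ℤ) → (∀ i → s i ≡ 1ℤ + ℤ.+ 2 * h i) →
      Σ (Frame m) λ F′ → ∀ i z → B (w F′ i) z ≡ s i * B (w F i) z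
    flip-frame {m} F s h s² s≡ = record
      { w = v ; mid = c ; w-norm = norm ; w-orth = orth ; mid-B = mid-v } , v-B
      where
      v : Fin m → Vec ℤ n
      v i = lin (s i) (w F i) 0ℤ (w F i)
      c : Fin m → Fin m → Vec ℤ n
      c i j = lin 1ℤ (mid F i j) 1ℤ (lin (h i) (w F i) (h j) (w F j))
      v-B : ∀ i z → B (v i) z ≡ s i * B (w F i) z
      v-B i z = trans (B-linˡ (s i) (w F i) 0ℤ (w F i) z) (+-identityʳ (s i * B (w F i) z))
      v-v : ∀ i j → B (v i) (v j) ≡ s i * (s j * B (w F i) (w F j))
      v-v i j = trans (v-B i (v j)) (cong (s i *_) (trans (B-sym (w F i) (v j))
        (trans (v-B j (w F i)) (cong (s j *_) (B-sym (w F j) (w F i))))))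
      norm : ∀ i → B (v i) (v i) ≡ ℤ.+ 4
      norm i = trans (v-v i i) (trans (sym (*-assoc (s i) (s i) (B (w F i) (w F i)))) (cong₂ _*_ (s² i) (w-norm F i)))
      orth : ∀ i j → i ≢ j → B (v i) (v j) ≡ 0ℤ
      orth i j i≢j = trans (v-v i j) (trans (cong (λ u → s i * (s j * u)) (w-orth F i j i≢j)) (zeros (s i) (s j)))
        where
        zeros : ∀ a b → a * (b * 0ℤ) ≡ 0ℤ
        zeros = solve-∀
      mid-v : ∀ i j z → ℤ.+ 2 * B (c i j) z ≡ B (v i) z + B (v j) z
      mid-v i j z = begin
        ℤ.+ 2 * B (c i j) z
          ≡⟨ cong (ℤ.+ 2 *_) (trans (B-linˡ 1ℤ (mid F i j) 1ℤ (lin (h i) (w F i) (h j) (w F j)) z)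
               (cong (λ u → 1ℤ * B (mid F i j) z + 1ℤ * u) (B-linˡ (h i) (w F i) (h j) (w F j) z))) ⟩
        ℤ.+ 2 * (1ℤ * B (mid F i j) z + 1ℤ * (h i * bᵢ + h j * bⱼ))
          ≡⟨ expand (B (mid F i j) z) (h i) bᵢ (h j) bⱼ ⟩
        ℤ.+ 2 * B (mid F i j) z + (ℤ.+ 2 * h i * bᵢ + ℤ.+ 2 * h j * bⱼ)
          ≡⟨ cong (_+ (ℤ.+ 2 * h i * bᵢ + ℤ.+ 2 * h j * bⱼ)) (mid-B F i j z) ⟩
        (bᵢ + bⱼ) + (ℤ.+ 2 * h i * bᵢ + ℤ.+ 2 * h j * bⱼ)
          ≡⟨ collect (h i) bᵢ (h j) bⱼ ⟩
        (1ℤ + ℤ.+ 2 * h i) * bᵢ + (1ℤ + ℤ.+ 2 * h j) * bⱼ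
          ≡⟨ cong₂ (λ a b → a * bᵢ + b * bⱼ) (sym (s≡ i)) (sym (s≡ j)) ⟩
        s i * bᵢ + s j * bⱼ
          ≡⟨ sym (cong₂ _+_ (v-B i z) (v-B j z)) ⟩
        B (v i) z + B (v j) z ∎
        where
        bᵢ = B (w F i) z
        bⱼ = B (w F j) z
        expand : ∀ m a b c d → ℤ.+ 2 * (1ℤ * m + 1ℤ * (a * b + c * d)) ≡ ℤ.+ 2 * m + (ℤ.+ 2 * a * b + ℤ.+ 2 * c * d)
        expand = solve-∀
        collect : ∀ a b c d → (b + d) + (ℤ.+ 2 * a * b + ℤ.+ 2 * c * d) ≡ (1ℤ + ℤ.+ 2 * a) * b + (1ℤ + ℤ.+ 2 * c) * d
        collect = solve-∀

    -- A root x with x₀ x₁ x₂ ≠ 0 has all coordinates ± ½.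
    spinor : ∀ {m} (F : Frame (suc (suc (suc m)))) →
      Σ (Frame (suc (suc (suc m)))) λ F′ → ∃ λ x → IsRoot x × (∀ i → B (w F′ i) x ≡ 1ℤ)
    spinor {m} F = F′ , x , qx , λ i → trans (v-B i x) (unit i)
      where
      w≢0 : ∀ i → B (w F i) (w F i) ≢ 0ℤ
      w≢0 i e = contradiction (trans (sym (w-norm F i)) e) λ ()
      0F 1F 2F : Fin (suc (suc (suc m)))
      0F = zero
      1F = suc zero
      2F = suc (suc zero)
      found = generic-root (w≢0 0F) (w≢0 1F) (w≢0 2F)
      x = proj₁ found
      qx : IsRoot x
      qx = proj₁ (proj₂ found)
      c : Fin (suc (suc (suc m))) → ℤ
      c i = B (w F i) x
      c₀≢0 : c 0F ≢ 0ℤ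
      c₀≢0 = proj₁ (proj₂ (proj₂ found))
      c₁≢0 : c 1F ≢ 0ℤ
      c₁≢0 = proj₁ (proj₂ (proj₂ (proj₂ found)))
      c₂≢0 : c 2F ≢ 0ℤ
      c₂≢0 = proj₂ (proj₂ (proj₂ (proj₂ found)))
      -- A third index l with xₗ ≠ 0 shows that x is not ± (e₀ ± eⱼ), whose l-th coordinate is 0.
      -- This is why three nonzero coordinates are requested.
      trits-via : ∀ l → c l ≢ 0ℤ → ∀ j → 0F ≢ j → 0F ≢ l → j ≢ l → Trit (B (mid F 0F j) x) × Trit (B (dif F 0F j) x)
      trits-via l cl≢0 j 0≢j 0≢l j≢l =
        root-trit (mid-root F 0≢j) qx (separated cl≢0 (trans (B-sym (w F l) (mid F 0F j))
          (mid-⊥ F (w-orth F 0F l 0≢l) (w-orth F j l j≢l)))) ,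
        root-trit (dif-root F 0≢j) qx (separated cl≢0 (trans (B-sym (w F l) (dif F 0F j))
          (dif-⊥ F (w-orth F 0F l 0≢l) (w-orth F j l j≢l))))
      trits : ∀ j → 0F ≢ j → Trit (B (mid F 0F j) x) × Trit (B (dif F 0F j) x)
      trits zero          0≢j = contradiction refl 0≢j
      trits (suc zero)    0≢j = trits-via 2F c₂≢0 1F (λ ()) (λ ()) (λ ())
      trits (suc (suc j)) 0≢j = trits-via 1F c₁≢0 (suc (suc j)) (λ ()) (λ ()) (λ ())
      c₀-split : ∀ j → c 0F ≡ B (mid F 0F j) x + B (dif F 0F j) x
      c₀-split j = wˡ-split F 0F j x
      unit₀ : c 0F * c 0F ≡ 1ℤ
      unit₀ = trans (cong (λ u → u * u) (c₀-split 1F)) (trits-nonzero (proj₁ (trits 1F λ ())) (proj₂ (trits 1F λ ()))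
        (subst (_≢ 0ℤ) (c₀-split 1F) c₀≢0) (subst (_≢ 0ℤ) (wʳ-split F 0F 1F x) c₁≢0))
      unit : ∀ i → c i * c i ≡ 1ℤ
      unit i with 0F Fin.≟ i
      ... | yes refl = unit₀
      ... | no 0≢i   = trans (cong (λ u → u * u) (wʳ-split F 0F i x)) (trits-odd (proj₁ (trits i 0≢i)) (proj₂ (trits i 0≢i))
        (trans (sym (cong (λ u → u * u) (c₀-split i))) unit₀))
      flipped = flip-frame F c (λ i → proj₁ (sign-half (c i) (unit i))) unit (λ i → proj₂ (sign-half (c i) (unit i)))
      F′ = proj₁ flipped
      v-B : ∀ i z → B (w F′ i) z ≡ c i * B (w F i) z
      v-B = proj₂ flipped

    -- The vector 4x - Σ 2eᵢ is orthogonal to the whole frame; if nonzero, it would be an orthogonal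
    -- vector too many. So x is half the sum of the eᵢ.
    spinor-coordinates : (F : Frame n) → ∀ x → (∀ i → B (w F i) x ≡ 1ℤ) →
      ∀ z → ℤ.+ 4 * B x z ≡ sumFin n (λ i → B (w F i) z)
    spinor-coordinates F x wx z = sym (begin
      sumFin n (λ i → B (w F i) z)
        ≡⟨ sym (Σw-B z) ⟩
      B Σw z
        ≡⟨ sym (i-j≡0⇒i≡j (ℤ.+ 4 * B x z) (B Σw z) (trans (sym (v-B z)) (B-null v≡0 z))) ⟩
      ℤ.+ 4 * B x z ∎)
      where
      Σw v : Vec ℤ n
      Σw = combination (λ _ → 1ℤ) (w F)
      v = lin (ℤ.+ 4) x -1ℤ Σw
      Σw-B : ∀ z → B Σw z ≡ sumFin n (λ i → B (w F i) z)
      Σw-B z = trans (B-combinationˡ (λ _ → 1ℤ) (w F) z) (sum-cong n λ i → *-identityˡ (B (w F i) z))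
      v-B : ∀ z → B v z ≡ ℤ.+ 4 * B x z - B Σw z
      v-B z = trans (B-linˡ (ℤ.+ 4) x -1ℤ Σw z) (cong (ℤ.+ 4 * B x z +_) (-1*i≡-i (B Σw z)))
      v⊥w : ∀ j → B v (w F j) ≡ 0ℤ
      v⊥w j = trans (v-B (w F j)) (cong₂ (λ a b → ℤ.+ 4 * a - b) (trans (B-sym x (w F j)) (wx j))
        (trans (Σw-B (w F j)) (trans (sum-single n (λ i → B (w F i) (w F j)) j (λ i i≢j → w-orth F i j i≢j)) (w-norm F j))))
      v≡0 : B v v ≡ 0ℤ
      v≡0 = decidable-stable (B v v ℤ.≟ 0ℤ) λ v≢0 → ℕₚ.1+n≰n (orthogonal-bound family (family≢0 v≢0) family-orth)
        where
        family : Fin (suc n) → Vec ℤ n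
        family zero    = v
        family (suc i) = w F i
        family≢0 : B v v ≢ 0ℤ → ∀ i → B (family i) (family i) ≢ 0ℤ
        family≢0 v≢0 zero      = v≢0
        family≢0 v≢0 (suc i) e = contradiction (trans (sym (w-norm F i)) e) λ ()
        family-orth : ∀ i j → i ≢ j → B (family i) (family j) ≡ 0ℤ
        family-orth zero    zero    i≢j = contradiction refl i≢j
        family-orth zero    (suc j) _   = v⊥w j
        family-orth (suc i) zero    _   = trans (B-sym (w F i) v) (v⊥w i)
        family-orth (suc i) (suc j) i≢j = w-orth F i j (i≢j ∘ cong suc)

    spinor-frame : 2 ℕ.≤ n → Σ (Frame n) λ F → ∃ λ x → IsRoot x × (∀ i → B (w F i) x ≡ 1ℤ)
    spinor-frame 2≤n = let (_ , e , F) = full-frame 2≤n in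
      subst (λ k → Σ (Frame k) λ F → ∃ λ x → IsRoot x × (∀ i → B (w F i) x ≡ 1ℤ)) e (spinor F)

    rank≡8 : (F : Frame n) → ∀ {x} → IsRoot x → (∀ i → B (w F i) x ≡ 1ℤ) → n ≡ 8
    rank≡8 F {x} qx wx = +-injective (sym (begin
      ℤ.+ 8                         ≡⟨ cong (ℤ.+ 4 *_) (sym qx) ⟩
      ℤ.+ 4 * B x x                 ≡⟨ spinor-coordinates F x wx x ⟩
      sumFin n (λ i → B (w F i) x)  ≡⟨ sum-cong n wx ⟩
      sumFin n (λ _ → 1ℤ)           ≡⟨ ones n ⟩
      ℤ.+ n                         ∎))
      where
      ones : ∀ n → sumFin n (λ _ → 1ℤ) ≡ ℤ.+ n
      ones zero    = refl
      ones (suc n) = cong (1ℤ +_) (ones n)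

  -- The lattice E8

  -- Integral since E8 is unimodular: the rows are the fundamental weights in terms of simple roots,
  -- the last one being the highest root.
  E8⁻¹ : Mat 8
  E8⁻¹ i j = ℤ.+ lookup (lookup rows i) j
    where
    rows : Vec (Vec ℕ 8) 8
    rows =
      ( 4 ∷  5 ∷  7 ∷ 10 ∷  8 ∷  6 ∷  4 ∷  2 ∷ []) ∷
      ( 5 ∷  8 ∷ 10 ∷ 15 ∷ 12 ∷  9 ∷  6 ∷  3 ∷ []) ∷
      ( 7 ∷ 10 ∷ 14 ∷ 20 ∷ 16 ∷ 12 ∷  8 ∷  4 ∷ []) ∷
      (10 ∷ 15 ∷ 20 ∷ 30 ∷ 24 ∷ 18 ∷ 12 ∷  6 ∷ []) ∷
      ( 8 ∷ 12 ∷ 16 ∷ 24 ∷ 20 ∷ 15 ∷ 10 ∷  5 ∷ []) ∷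
      ( 6 ∷  9 ∷ 12 ∷ 18 ∷ 15 ∷ 12 ∷  8 ∷  4 ∷ []) ∷
      ( 4 ∷  6 ∷  8 ∷ 12 ∷ 10 ∷  8 ∷  6 ∷  3 ∷ []) ∷
      ( 2 ∷  3 ∷  4 ∷  6 ∷  5 ∷  4 ∷  3 ∷  2 ∷ []) ∷
      []

  E8⁻¹·E8 : ∀ i j → (E8⁻¹ · E8) i j ≡ idMat i j
  E8⁻¹·E8 = toWitness {a? = Finₚ.all? λ i → Finₚ.all? λ j → (E8⁻¹ · E8) i j ℤ.≟ idMat i j} _

  digits : ∀ n → ℕ → Vec ℤ n
  digits zero    N = []
  digits (suc n) N = ℤ.+ (N % 10) ∷ digits n (N / 10)

  -- The coefficient of the simple root αᵢ is the i-th decimal digit from the right.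
  E8-positive-roots : List (Vec ℤ 8)
  E8-positive-roots = List.map (digits 8) (
    1 ∷ 10 ∷ 100 ∷ 101 ∷ 1000 ∷ 1010 ∷ 1100 ∷ 1101 ∷
    1110 ∷ 1111 ∷ 10000 ∷ 11000 ∷ 11010 ∷ 11100 ∷ 11101 ∷ 11110 ∷
    11111 ∷ 12110 ∷ 12111 ∷ 12211 ∷ 100000 ∷ 110000 ∷ 111000 ∷ 111010 ∷
    111100 ∷ 111101 ∷ 111110 ∷ 111111 ∷ 112110 ∷ 112111 ∷ 112211 ∷ 122110 ∷
    122111 ∷ 122211 ∷ 123211 ∷ 123221 ∷ 1000000 ∷ 1100000 ∷ 1110000 ∷ 1111000 ∷
    1111010 ∷ 1111100 ∷ 1111101 ∷ 1111110 ∷ 1111111 ∷ 1112110 ∷ 1112111 ∷ 1112211 ∷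
    1122110 ∷ 1122111 ∷ 1122211 ∷ 1123211 ∷ 1123221 ∷ 1222110 ∷ 1222111 ∷ 1222211 ∷
    1223211 ∷ 1223221 ∷ 1233211 ∷ 1233221 ∷ 1234221 ∷ 1234321 ∷ 1234322 ∷ 10000000 ∷
    11000000 ∷ 11100000 ∷ 11110000 ∷ 11111000 ∷ 11111010 ∷ 11111100 ∷ 11111101 ∷ 11111110 ∷
    11111111 ∷ 11112110 ∷ 11112111 ∷ 11112211 ∷ 11122110 ∷ 11122111 ∷ 11122211 ∷ 11123211 ∷
    11123221 ∷ 11222110 ∷ 11222111 ∷ 11222211 ∷ 11223211 ∷ 11223221 ∷ 11233211 ∷ 11233221 ∷
    11234221 ∷ 11234321 ∷ 11234322 ∷ 12222110 ∷ 12222111 ∷ 12222211 ∷ 12223211 ∷ 12223221 ∷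
    12233211 ∷ 12233221 ∷ 12234221 ∷ 12234321 ∷ 12234322 ∷ 12333211 ∷ 12333221 ∷ 12334221 ∷
    12334321 ∷ 12334322 ∷ 12344221 ∷ 12344321 ∷ 12344322 ∷ 12345321 ∷ 12345322 ∷ 12345331 ∷
    12345332 ∷ 12345422 ∷ 12345432 ∷ 12346432 ∷ 12356432 ∷ 12456432 ∷ 13456432 ∷ 23456432 ∷ [])

  E8-positive-roots-norm : All (λ x → Q E8 x ≡ ℤ.+ 2) E8-positive-roots
  E8-positive-roots-norm = toWitness {a? = All.all? (λ x → Q E8 x ℤ.≟ ℤ.+ 2) E8-positive-roots} _

  E8-positive-roots-pairs : AllPairs _≁_ E8-positive-roots
  E8-positive-roots-pairs = toWitness
    {a? = AllPairs.allPairs? (λ x y → ¬? (x ≟ᵥ y) ×-dec ¬? (x ≟ᵥ neg y)) E8-positive-roots} _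

  +t*z+w≢0 : ∀ {t z w} → z ≢ 0ℤ → ℤ.∣ w ∣ ℕ.< t → ℤ.+ t * z + 1ℤ * w ≢ 0ℤ
  +t*z+w≢0 {t} {z} {w} z≢0 ∣w∣<t e = ℕₚ.<⇒≱ ∣w∣<t (ℕₚ.≤-trans
    (ℕₚ.m≤m*n t ℤ.∣ z ∣ {{ℕ.≢-nonZero (z≢0 ∘ ∣i∣≡0⇒i≡0)}}) (ℕₚ.≤-reflexive (begin
      t ℕ.* ℤ.∣ z ∣      ≡⟨ sym (abs-* (ℤ.+ t) z) ⟩
      ℤ.∣ ℤ.+ t * z ∣    ≡⟨ cong ℤ.∣_∣ (isolate (ℤ.+ t * z) w e) ⟩
      ℤ.∣ - w ∣          ≡⟨ ∣-i∣≡∣i∣ w ⟩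
      ℤ.∣ w ∣            ∎)))
    where
    isolate : ∀ a b → a + 1ℤ * b ≡ 0ℤ → a ≡ - b
    isolate a b e = trans (rewrite-a a b) (trans (cong (_- b) e) (+-identityˡ (- b)))
      where
      rewrite-a : ∀ a b → a ≡ (a + 1ℤ * b) - b
      rewrite-a = solve-∀

  module RootShell {n : ℕ} (G : Mat n) (gram : IntegralGram G) (1≤n : 1 ℕ.≤ n) {P : List (Vec ℤ n)}
    (half : Shell.HalfShell G gram 1 P) where

    open ShellFacts G gram 1

    -- If y lies on the hyperplane of a new `a`, then t y + a does not, and for large t the values
    -- already nonzero at y cannot be cancelled by those at a.
    generic-point : ∀ as → All (λ a → Q G a ≢ 0ℤ) as → ∃ λ y → All (λ a → B a y ≢ 0ℤ) as
    generic-point []       []         = zeroVec n , []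
    generic-point (a ∷ as) (a≢0 ∷ nz) with generic-point as nz
    ... | y , ys with B a y ℤ.≟ 0ℤ
    ...   | no ay≢0  = y , ay≢0 ∷ ys
    ...   | yes ay≡0 = lin (ℤ.+ t) y 1ℤ a ,
      (λ e → a≢0 (trans (sym (head (ℤ.+ t) (Q G a)))
        (trans (cong (λ u → ℤ.+ t * u + 1ℤ * Q G a) (sym ay≡0)) (trans (sym (B-linʳ a (ℤ.+ t) y 1ℤ a)) e)))) ∷
      All.zipWith (λ {b} (by≢0 , lt) e → +t*z+w≢0 {t} {B b y} {B b a} by≢0 lt (trans (sym (B-linʳ b (ℤ.+ t) y 1ℤ a)) e))
        (ys , proj₂ (large as))
      where
      large : ∀ bs → ∃ λ t → All (λ b → ℤ.∣ B b a ∣ ℕ.< t) bs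
      large []       = 0 , []
      large (b ∷ bs) = let (t , lts) = large bs in
        suc (ℤ.∣ B b a ∣ ℕ.+ t) , ℕ.s≤s (ℕₚ.m≤m+n _ t) ∷
          All.map (λ lt → ℕₚ.≤-trans lt (ℕₚ.≤-trans (ℕₚ.m≤n+m t ℤ.∣ B b a ∣) (ℕₚ.n≤1+n _))) lts
      t = proj₁ (large as)
      head : ∀ t q → t * 0ℤ + 1ℤ * q ≡ q
      head = solve-∀

    generic-root : ∀ {a b c} → Q G a ≢ 0ℤ → Q G b ≢ 0ℤ → Q G c ≢ 0ℤ →
      ∃ λ x → OnShell x × B a x ≢ 0ℤ × B b x ≢ 0ℤ × B c x ≢ 0ℤ
    generic-root {a} {b} {c} a≢0 b≢0 c≢0 with generic-point (a ∷ b ∷ c ∷ []) (a≢0 ∷ b≢0 ∷ c≢0 ∷ [])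
    ... | y , ay≢0 ∷ by≢0 ∷ cy≢0 ∷ [] with nonvanishing {y = y} half (form-B a (form-B b (form-B₁ c)))
                                             (*-≢0 ay≢0 (*-≢0 by≢0 cy≢0))
    ... | x , qx , px≢0 = x , qx , proj₁ (*-≢0⁻ {B a x} px≢0) ,
          *-≢0⁻ {B b x} (proj₂ (*-≢0⁻ {B a x} px≢0))

    rootLattice : RootLattice n
    rootLattice = record
      { B = B
      ; B-sym = B-sym
      ; B-linˡ = B-linˡ
      ; B-combinationˡ = bil-combinationˡ G
      ; B-negʳ = B-negʳ
      ; B-null = λ {x} e y → trans (cong (λ v → B v y) (Q≡0⇒≡0 {x} e)) (B-zeroˡ y)
      ; orthogonal-vector = λ m<n w → let (a , a≢0 , orth) = orthogonal-vector m<n w in a , ≢0⇒Q≢0 a≢0 , orth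
      ; orthogonal-bound = orthogonal-bound
      ; root-bound = λ {x} {y} qx qy (x≢y , x≢-y) → ∣B∣<k {x} {y} qx qy x≢y x≢-y
      ; root = shell-vector half 1≤n
      ; generic-root = λ {a} {b} {c} → generic-root {a} {b} {c}
      }

  -- The vectors eᵢ ± eⱼ in units of ½eₗ; in these units 2eⱼ has the single entry 4, and the root x
  -- has all entries 1.
  midRow difRow : Fin 8 → Fin 8 → Fin 8 → ℤ
  midRow i j l = ℤ.+ 2 * idMat i l + ℤ.+ 2 * idMat j l
  difRow i j l = 1ℤ * midRow i j l + -1ℤ * (ℤ.+ 4 * idMat j l)

  -- Coordinates, in the basis ½eᵢ, of the Bourbaki simple roots
  -- ½(e₁ + e₈ − e₂ − ⋯ − e₇), e₁ + e₂, e₂ − e₁, e₃ − e₂, …, e₇ − e₆.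
  simpleRows : Vec (Fin 8 → ℤ) 8
  simpleRows =
    -- The root x minus e₂ + e₃, e₄ + e₅ and e₆ + e₇, bracketed exactly as `coordinates-lin` yields
    -- it in `simpleRoot`.
    (λ l → 1ℤ * (1ℤ * 1ℤ + -1ℤ * midRow (# 1) (# 2) l) + -1ℤ * (1ℤ * midRow (# 3) (# 4) l + 1ℤ * midRow (# 5) (# 6) l)) ∷
    midRow (# 0) (# 1) ∷ difRow (# 1) (# 0) ∷ difRow (# 2) (# 1) ∷ difRow (# 3) (# 2) ∷
    difRow (# 4) (# 3) ∷ difRow (# 5) (# 4) ∷ difRow (# 6) (# 5) ∷ []

  simpleRow : Fin 8 → Fin 8 → ℤ
  simpleRow = lookup simpleRows

  -- The 4 makes up for the norm ¼ of ½eₗ.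
  simpleRow-gram : ∀ i j → sumFin 8 (λ l → simpleRow i l * simpleRow j l) ≡ ℤ.+ 4 * E8 i j
  simpleRow-gram = toWitness {a? = Finₚ.all? λ i → Finₚ.all? λ j →
    sumFin 8 (λ l → simpleRow i l * simpleRow j l) ℤ.≟ ℤ.+ 4 * E8 i j} _

  module E8Basis (L : RootLattice 8) (F : Roots.Frame L 8) (x : Vec ℤ 8)
    (wx : ∀ i → RootLattice.B L (Roots.Frame.w F i) x ≡ 1ℤ) where

    open RootLattice L
    open Roots L
    open Frame F

    -- Expresses v = Σ aₗ(½eₗ) as 4v = Σ aₗ(2eₗ), tested against all z.
    record Coordinates (v : Vec ℤ 8) (a : Fin 8 → ℤ) : Set where
      constructor coordinates
      field expand : ∀ z → ℤ.+ 4 * B v z ≡ sumFin 8 (λ l → a l * B (w l) z)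

    open Coordinates

    coordinates-lin : ∀ {u v a b} p q → Coordinates u a → Coordinates v b →
      Coordinates (lin p u q v) (λ l → p * a l + q * b l)
    coordinates-lin {u} {v} {a} {b} p q cu cv = coordinates λ z → begin
      ℤ.+ 4 * B (lin p u q v) z
        ≡⟨ cong (ℤ.+ 4 *_) (B-linˡ p u q v z) ⟩
      ℤ.+ 4 * (p * B u z + q * B v z)
        ≡⟨ move p (B u z) q (B v z) ⟩
      p * (ℤ.+ 4 * B u z) + q * (ℤ.+ 4 * B v z)
        ≡⟨ cong₂ (λ r s → p * r + q * s) (expand cu z) (expand cv z) ⟩
      p * sumFin 8 (λ l → a l * B (w l) z) + q * sumFin 8 (λ l → b l * B (w l) z)
        ≡⟨ sym (cong₂ _+_ (sum-*ˡ 8 p (λ l → a l * B (w l) z)) (sum-*ˡ 8 q (λ l → b l * B (w l) z))) ⟩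
      sumFin 8 (λ l → p * (a l * B (w l) z)) + sumFin 8 (λ l → q * (b l * B (w l) z))
        ≡⟨ sym (sum-+ 8 (λ l → p * (a l * B (w l) z)) (λ l → q * (b l * B (w l) z))) ⟩
      sumFin 8 (λ l → p * (a l * B (w l) z) + q * (b l * B (w l) z))
        ≡⟨ sum-cong 8 (λ l → collect p (a l) q (b l) (B (w l) z)) ⟩
      sumFin 8 (λ l → (p * a l + q * b l) * B (w l) z) ∎
      where
      move : ∀ p u q v → ℤ.+ 4 * (p * u + q * v) ≡ p * (ℤ.+ 4 * u) + q * (ℤ.+ 4 * v)
      move = solve-∀
      collect : ∀ p a q b c → p * (a * c) + q * (b * c) ≡ (p * a + q * b) * c
      collect = solve-∀

    coordinates-w : ∀ i → Coordinates (w i) (λ l → ℤ.+ 4 * idMat i l)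
    coordinates-w i = coordinates λ z → sym (trans (sum-cong 8 λ l → *-assoc (ℤ.+ 4) (idMat i l) (B (w l) z))
      (trans (sum-*ˡ 8 (ℤ.+ 4) (λ l → idMat i l * B (w l) z)) (cong (ℤ.+ 4 *_) (idMat-sum (λ l → B (w l) z) i))))

    coordinates-mid : ∀ i j → Coordinates (mid i j) (midRow i j)
    coordinates-mid i j = coordinates λ z → begin
      ℤ.+ 4 * B (mid i j) z
        ≡⟨ *-assoc (ℤ.+ 2) (ℤ.+ 2) (B (mid i j) z) ⟩
      ℤ.+ 2 * (ℤ.+ 2 * B (mid i j) z)
        ≡⟨ cong (ℤ.+ 2 *_) (mid-B i j z) ⟩
      ℤ.+ 2 * (B (w i) z + B (w j) z)
        ≡⟨ cong₂ (λ a b → ℤ.+ 2 * (a + b)) (sym (idMat-sum (λ l → B (w l) z) i)) (sym (idMat-sum (λ l → B (w l) z) j)) ⟩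
      ℤ.+ 2 * (sumFin 8 (λ l → idMat i l * B (w l) z) + sumFin 8 (λ l → idMat j l * B (w l) z))
        ≡⟨ cong (ℤ.+ 2 *_) (sym (sum-+ 8 (λ l → idMat i l * B (w l) z) (λ l → idMat j l * B (w l) z))) ⟩
      ℤ.+ 2 * sumFin 8 (λ l → idMat i l * B (w l) z + idMat j l * B (w l) z)
        ≡⟨ sym (sum-*ˡ 8 (ℤ.+ 2) (λ l → idMat i l * B (w l) z + idMat j l * B (w l) z)) ⟩
      sumFin 8 (λ l → ℤ.+ 2 * (idMat i l * B (w l) z + idMat j l * B (w l) z))
        ≡⟨ sum-cong 8 (λ l → collect (idMat i l) (idMat j l) (B (w l) z)) ⟩
      sumFin 8 (λ l → midRow i j l * B (w l) z) ∎
      where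
      collect : ∀ a b c → ℤ.+ 2 * (a * c + b * c) ≡ (ℤ.+ 2 * a + ℤ.+ 2 * b) * c
      collect = solve-∀

    coordinates-dif : ∀ i j → Coordinates (dif i j) (difRow i j)
    coordinates-dif i j = coordinates-lin 1ℤ -1ℤ (coordinates-mid i j) (coordinates-w j)

    coordinates-x : Coordinates x (λ _ → 1ℤ)
    coordinates-x = coordinates λ z → trans (spinor-coordinates F x wx z) (sum-cong 8 λ l → sym (*-identityˡ (B (w l) z)))

    coordinates-B : ∀ {u v a b} → Coordinates u a → Coordinates v b → ℤ.+ 4 * B u v ≡ sumFin 8 (λ l → a l * b l)
    coordinates-B {u} {v} {a} {b} cu cv = trans (expand cu v) (sum-cong 8 λ l → cong (a l *_)
      (*-cancelˡ-≡ (ℤ.+ 4) (B (w l) v) (b l) (begin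
        ℤ.+ 4 * B (w l) v
          ≡⟨ cong (ℤ.+ 4 *_) (B-sym (w l) v) ⟩
        ℤ.+ 4 * B v (w l)
          ≡⟨ expand cv (w l) ⟩
        sumFin 8 (λ m → b m * B (w m) (w l))
          ≡⟨ sum-single 8 (λ m → b m * B (w m) (w l)) l
               (λ m m≢l → trans (cong (b m *_) (w-orth m l m≢l)) (*-zeroʳ (b m))) ⟩
        b l * B (w l) (w l)
          ≡⟨ trans (cong (b l *_) (w-norm l)) (*-comm (b l) (ℤ.+ 4)) ⟩
        ℤ.+ 4 * b l ∎)))

    simpleRoot : ∀ i → ∃ λ v → Coordinates v (simpleRow i)
    simpleRoot zero = _ , coordinates-lin 1ℤ -1ℤ (coordinates-lin 1ℤ -1ℤ coordinates-x (coordinates-mid (# 1) (# 2)))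
      (coordinates-lin 1ℤ 1ℤ (coordinates-mid (# 3) (# 4)) (coordinates-mid (# 5) (# 6)))
    simpleRoot (suc zero) = _ , coordinates-mid (# 0) (# 1)
    simpleRoot (suc (suc zero)) = _ , coordinates-dif (# 1) (# 0)
    simpleRoot (suc (suc (suc zero))) = _ , coordinates-dif (# 2) (# 1)
    simpleRoot (suc (suc (suc (suc zero)))) = _ , coordinates-dif (# 3) (# 2)
    simpleRoot (suc (suc (suc (suc (suc zero))))) = _ , coordinates-dif (# 4) (# 3)
    simpleRoot (suc (suc (suc (suc (suc (suc zero)))))) = _ , coordinates-dif (# 5) (# 4)
    simpleRoot (suc (suc (suc (suc (suc (suc (suc zero))))))) = _ , coordinates-dif (# 6) (# 5)

    simpleRoot-gram : ∀ i j → B (proj₁ (simpleRoot i)) (proj₁ (simpleRoot j)) ≡ E8 i j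
    simpleRoot-gram i j = *-cancelˡ-≡ (ℤ.+ 4) (B (proj₁ (simpleRoot i)) (proj₁ (simpleRoot j))) (E8 i j)
      (trans (coordinates-B (proj₂ (simpleRoot i)) (proj₂ (simpleRoot j))) (simpleRow-gram i j))

  E8-basis : ∀ {n} (L : RootLattice n) → 2 ℕ.≤ n → Σ (n ≡ 8) λ e →
    Σ (Fin n → Vec ℤ n) λ v → ∀ i j → RootLattice.B L (v i) (v j) ≡ subst Mat (sym e) E8 i j
  E8-basis {n} L 2≤n = let (F , x , qx , wx) = Roots.spinor-frame L 2≤n in build L F x wx (Roots.rank≡8 L F {x} qx wx)
    where
    build : ∀ {n} (L : RootLattice n) (F : Roots.Frame L n) x →
      (∀ i → RootLattice.B L (Roots.Frame.w F i) x ≡ 1ℤ) → n ≡ 8 →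
      Σ (n ≡ 8) λ e → Σ (Fin n → Vec ℤ n) λ v → ∀ i j → RootLattice.B L (v i) (v j) ≡ subst Mat (sym e) E8 i j
    build L F x wx refl = refl , proj₁ ∘ E8Basis.simpleRoot L F x wx , E8Basis.simpleRoot-gram L F x wx

  halfShell₂⇒E8 : ∀ {n} (G : Mat n) (gram : IntegralGram G) → 2 ℕ.≤ n → ∀ {P} → Shell.HalfShell G gram 1 P →
    Σ (n ≡ 8) λ e → Isometric (subst Mat e G) E8
  halfShell₂⇒E8 G gram 2≤n half = conclude G (E8-basis (RootShell.rootLattice G gram (ℕₚ.<⇒≤ 2≤n) half) 2≤n)
    where
    conclude : ∀ {n} (G : Mat n) → (Σ (n ≡ 8) λ e →
      Σ (Fin n → Vec ℤ n) λ v → ∀ i j → bil G (v i) (v j) ≡ subst Mat (sym e) E8 i j) →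
      Σ (n ≡ 8) λ e → Isometric (subst Mat e G) E8
    conclude G (refl , v , gramv) = refl , isometric-from-basis G E8 E8⁻¹ v gramv E8⁻¹·E8

  -- The two implications

  -- The right-hand side is what `2 * suc k ∸ 1` reduces to.
  deg≡ : ∀ k → deg k ≡ k ℕ.+ suc (k ℕ.+ 0)
  deg≡ zero    = refl
  deg≡ (suc k) = cong suc (trans (cong suc (deg≡ k)) (sym (ℕₚ.+-suc k (suc (k ℕ.+ 0)))))

  binomial≡dim : ∀ n k → (suc n ℕ.+ 2 ℕ.* suc k ℕ.∸ 2) C (2 ℕ.* suc k ℕ.∸ 1) ≡ dim (suc n) (deg k)
  binomial≡dim n k = begin
    (n ℕ.+ suc d ℕ.∸ 1) C d   ≡⟨ cong (λ m → (m ℕ.∸ 1) C d) (ℕₚ.+-suc n d) ⟩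
    (n ℕ.+ d) C d             ≡⟨ sym (dim-C n d) ⟩
    dim (suc n) d             ≡⟨ cong (dim (suc n)) (sym (deg≡ k)) ⟩
    dim (suc n) (deg k)       ∎
    where d = k ℕ.+ suc (k ℕ.+ 0)

  rank₁-form : ∀ g m → m * g * m + 0ℤ + 0ℤ ≡ g * m * m
  rank₁-form = solve-∀

  -- One variable has a single monomial in each degree, so one vector already makes up a half shell.
  numEq-rank₁ : (G : Mat 1) (gram : IntegralGram G) → ∀ k m → G zero zero * m * m ≡ ℤ.+ suc k →
    NumEq G (suc k) (2 ℕ.* dim 1 (deg k))
  numEq-rank₁ G gram k m e = Shell.complete G gram k {(m ∷ []) ∷ []}
    (trans (rank₁-form (G zero zero) m) e ∷ [] , [] ∷ [] , sym (trans (dim-C 0 (deg k)) (nCn≡1 (deg k))))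

  numEq-ℤⁿ : ∀ {n} → IntegralGram (idMat {n}) → NumEq {n} idMat 1 (2 ℕ.* dim n 1)
  numEq-ℤⁿ {n} gram = Shell.complete idMat gram 0 {List.tabulate unit}
    (Allₚ.tabulate⁺ norm , AllPairsₚ.tabulate⁺ distinct , trans (Listₚ.length-tabulate unit) (sym (dim-1 n)))
    where
    unit : Fin n → Vec ℤ n
    unit i = Vec.tabulate (idMat i)
    lookup-unit : ∀ i j → lookup (unit i) j ≡ idMat i j
    lookup-unit i = Vecₚ.lookup∘tabulate (idMat i)
    norm : ∀ i → Q idMat (unit i) ≡ 1ℤ
    norm i = begin
      Q idMat (unit i)
        ≡⟨ bil-apply idMat (unit i) (unit i) ⟩
      sumFin n (λ j → lookup (unit i) j * sumFin n (λ l → idMat j l * lookup (unit i) l))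
        ≡⟨ sum-cong n (λ j → cong₂ _*_ (lookup-unit i j) (trans (idMat-sum (lookup (unit i)) j) (lookup-unit i j))) ⟩
      sumFin n (λ j → idMat i j * idMat i j)
        ≡⟨ trans (idMat-sum (idMat i) i) (idMat-diag i) ⟩
      1ℤ ∎
    distinct : ∀ {i j} → i ≢ j → unit i ≁ unit j
    distinct {i} {j} i≢j = (λ e → uiᵢ≢0 (trans (cong (λ v → lookup v i) e) ujᵢ)) ,
      λ e → uiᵢ≢0 (trans (cong (λ v → lookup v i) e) (trans (Vecₚ.lookup-map i (-_) (unit j)) (cong (-_) ujᵢ)))
      where
      ujᵢ : lookup (unit j) i ≡ 0ℤ
      ujᵢ = trans (lookup-unit j i) (idMat-off (i≢j ∘ sym))
      uiᵢ≢0 : lookup (unit i) i ≢ 0ℤ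
      uiᵢ≢0 e = contradiction (trans (sym (trans (lookup-unit i i) (idMat-diag i))) e) λ ()

  -- The final `refl` is the coincidence behind the exceptional case: E8 has 120 positive roots, and
  -- 120 = C(10,3).
  numEq-E8 : IntegralGram E8 → NumEq E8 2 (2 ℕ.* dim 8 3)
  numEq-E8 gram = Shell.complete E8 gram 1 {E8-positive-roots} (E8-positive-roots-norm , E8-positive-roots-pairs , refl)

  extremal⇒ : ∀ {n} (G : Mat n) (gram : IntegralGram G) k → 1 ℕ.≤ n → NumEq G (suc k) (2 ℕ.* dim n (deg k)) →
    (Σ (n ≡ 1) λ e → ∃ λ (m : ℤ) → subst Mat e G zero zero * m * m ≡ ℤ.+ suc k)
    ⊎ ((n ℕ.≥ 2) × (suc k ≡ 1) × Isometric G idMat)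
    ⊎ (Σ (n ≡ 8) λ e → (suc k ≡ 2) × Isometric (subst Mat e G) E8)
  extremal⇒ {suc zero} G gram k 1≤n count with ShellFacts.shell-vector G gram k (proj₂ (Shell.halve G gram k count)) 1≤n
  ... | m ∷ [] , qx = inj₁ (refl , m , trans (sym (rank₁-form (G zero zero) m)) qx)
  extremal⇒ {suc (suc n)} G gram zero _ count =
    inj₂ (inj₁ (s≤s (s≤s z≤n) , refl , halfShell₁⇒ℤⁿ G gram (proj₂ (Shell.halve G gram 0 count))))
  extremal⇒ {suc (suc n)} G gram (suc zero) _ count =
    let (e , iso) = halfShell₂⇒E8 G gram (s≤s (s≤s z≤n)) (proj₂ (Shell.halve G gram 1 count)) in
    inj₂ (inj₂ (e , refl , iso))
  extremal⇒ {suc (suc n)} G gram (suc (suc m)) _ count = contradiction (proj₂ (Shell.halve G gram (suc (suc m)) count))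
    (no-halfShell G gram (suc m) (s≤s z≤n) (s≤s (s≤s z≤n)))

  extremal⇐ : ∀ {n} (G : Mat n) (gram : IntegralGram G) k →
    (Σ (n ≡ 1) λ e → ∃ λ (m : ℤ) → subst Mat e G zero zero * m * m ≡ ℤ.+ suc k)
    ⊎ ((n ℕ.≥ 2) × (suc k ≡ 1) × Isometric G idMat)
    ⊎ (Σ (n ≡ 8) λ e → (suc k ≡ 2) × Isometric (subst Mat e G) E8) →
    NumEq G (suc k) (2 ℕ.* dim n (deg k))
  extremal⇐ G gram k (inj₁ (refl , m , e)) = numEq-rank₁ G gram k m e
  extremal⇐ G gram k (inj₂ (inj₁ (_ , refl , iso))) =
    Transfer.numEq gram iso (numEq-ℤⁿ (Transfer.gram′ gram iso))
  extremal⇐ G gram k (inj₂ (inj₂ (refl , refl , iso))) =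
    Transfer.numEq gram iso (numEq-E8 (Transfer.gram′ gram iso))

open import Data.Nat using (ℕ; suc; _≥_; _*_; _+_; _∸_)
open import Data.Nat.Combinatorics using (_C_)
open import Data.Integer as ℤ using (ℤ; +_)
open import Data.Fin using (zero)
open import Data.Product using (Σ; ∃; _×_)
open import Data.Sum using (_⊎_)
open import Relation.Binary.PropositionalEquality using (_≡_; subst; sym)
open import Function.Bundles using (_⇔_; mk⇔)

theorem1p1 : (n : ℕ) → n ≥ 1 → (G : Mat n) → IntegralGram G →
    (k : ℕ) → k ≥ 1 →
    NumEq G k (2 * ((n + 2 * k ∸ 2) C (2 * k ∸ 1))) ⇔
    ((Σ (n ≡ 1) λ e → ∃ λ (m : ℤ) → subst Mat e G zero zero ℤ.* m ℤ.* m ≡ + k)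
    ⊎ ((n ≥ 2) × (k ≡ 1) × Isometric G idMat)
    ⊎ (Σ (n ≡ 8) λ e → (k ≡ 2) × Isometric (subst Mat e G) E8))
theorem1p1 (suc n) 1≤n G gram (suc k) _ = mk⇔
  (λ count → Extremal.extremal⇒ G gram k 1≤n (subst Count binomial≡dim count))
  (λ cases → subst Count (sym binomial≡dim) (Extremal.extremal⇐ G gram k cases))
  where
  Count : ℕ → Set
  Count N = NumEq G (suc k) (2 * N)
  binomial≡dim = Extremal.binomial≡dim n k
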